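{- Let $n\ge d$ be positive integers, $L=\{\ell_1,\dots,\ell_n\}$, $R=\{r_1,\dots,r_d\}$, and let $\mathcal M=(M_\sigma)$ be a linkage $(n,d)$-matching field on $L\sqcup R$. Then the map sending each Chow covector $\Omega_\rho$ of $\mathcal M$ to its right degree vector is a bijection from the set of Chow covectors of $\mathcal M$ onto the set of lattice points of $(n-d+1)\Delta_{d-1}$, i.e. onto $\{v\in\mathbb Z_{\ge0}^d:\sum_i v_i=n-d+1\}$.
   Context: Bipartite graphs on $L\sqcup R$ are identified with their edge sets. The left degree vector of such a graph is the tuple of degrees of $\ell_1,\dots,\ell_n$, and the right degree vector is the tuple of degrees of $r_1,\dots,r_d$. An $(n,d)$-matching field $\mathcal M=(M_\sigma)$ assigns to each $d$-element subset $\sigma\subseteq L$ a perfect matching $M_\sigma$ on $\sigma\sqcup R$; we write $M_\sigma(\ell_j)$ for the right node matched to $\ell_j\in\sigma$. The matching field is linkage if, for every $(d+1)$-subset $\tau\subseteq L$, the union of the $d+1$ matchings $M_\sigma$ with $\sigma\subset\tau$, $|\sigma|=d$, is a tree on $\tau\sqcup R$. For an $(n-d+1)$-subset $\rho\subseteq L$, the Chow covector $\Omega_\rho$ is the bipartite graph with edge set $\{(\ell_j,M_{(L\setminus\rho)\cup\{\ell_j\}}(\ell_j)):\ell_j\in\rho\}$. -}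

module Defs where

open import Data.Nat using (ℕ; zero; suc; _+_; _∸_; _≤_)
open import Data.Bool using (Bool; true; false; _∧_; T)
open import Data.Fin using (Fin; zero; suc; inject₁; fromℕ)
open import Data.Fin.Properties using () renaming (_≟_ to _≟F_)
open import Data.Fin.Subset using (Subset; _∈_; _⊆_; ∣_∣; ⁅_⁆; ∁; _∪_)
open import Data.Fin.Subset.Properties using (_∈?_)
open import Data.Vec using (Vec; lookup; tabulate; sum)
open import Data.List using (List; length; filter; allFin)
open import Data.Sum using (_⊎_; inj₁; inj₂)
open import Data.Product using (Σ; ∃; _×_; _,_)
open import Data.Unit using (⊤)
open import Relation.Nullary using (¬_; does)
open import Relation.Binary.PropositionalEquality using (_≡_)

EdgePred : ℕ → ℕ → Set₁
EdgePred n d = Fin n → Fin d → Set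

-- A bipartite graph as a finite edge set (adjacency matrix); equality of
-- graphs is then propositional equality of edge sets.
Graph : ℕ → ℕ → Set
Graph n d = Vec (Vec Bool d) n

edgeOf : ∀ {n d} → Graph n d → EdgePred n d
edgeOf G i r = T (lookup (lookup G i) r)

Vtx : ℕ → ℕ → Set
Vtx n d = Fin n ⊎ Fin d

InV : ∀ {n d} → Subset n → Vtx n d → Set
InV τ (inj₁ i) = i ∈ τ
InV τ (inj₂ r) = ⊤

data Reach {n d : ℕ} (E : EdgePred n d) : Vtx n d → Vtx n d → Set where
  here   : ∀ {v} → Reach E v v
  stepLR : ∀ {i r w} → E i r → Reach E (inj₂ r) w → Reach E (inj₁ i) w
  stepRL : ∀ {i r w} → E i r → Reach E (inj₁ i) w → Reach E (inj₂ r) w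

-- A cycle in a bipartite graph: distinct left nodes a₀..a_{k-1}, distinct
-- right nodes b₀..b_{k-1} (k = m+2 ≥ 2) with edges a_i–b_i, b_i–a_{i+1}
-- and b_{k-1}–a_0.
record Cycle {n d : ℕ} (E : EdgePred n d) (m : ℕ) : Set where
  field
    a : Fin (suc (suc m)) → Fin n
    b : Fin (suc (suc m)) → Fin d
    a-inj : ∀ i j → a i ≡ a j → i ≡ j
    b-inj : ∀ i j → b i ≡ b j → i ≡ j
    e-ab  : ∀ i → E (a i) (b i)
    e-ba  : ∀ (i : Fin (suc m)) → E (a (suc i)) (b (inject₁ i))
    e-close : E (a zero) (b (fromℕ (suc m)))

-- E is a tree on the vertex set τ ⊔ R (all edges of E are assumed to lie
-- in τ ⊔ R): connected on τ ⊔ R and acyclic.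
IsTreeOn : ∀ {n d} → Subset n → EdgePred n d → Set
IsTreeOn {n} {d} τ E =
  ((u v : Vtx n d) → InV τ u → InV τ v → Reach E u v)
  × (∀ m → ¬ Cycle E m)

-- An (n,d)-matching field: M σ j is the right node matched to ℓ_j by M_σ.
-- Values for σ with |σ| ≠ d, or j ∉ σ, are irrelevant.
record MatchingField (n d : ℕ) : Set where
  field
    M : Subset n → Fin n → Fin d
    -- M_σ is a perfect matching on σ ⊔ R: injective on σ (|σ| = d = |R|)
    perfect : ∀ σ → ∣ σ ∣ ≡ d → ∀ i j → i ∈ σ → j ∈ σ → M σ i ≡ M σ j → i ≡ j

open MatchingField public

unionMatchings : ∀ {n d} → MatchingField n d → Subset n → EdgePred n d
unionMatchings {n} {d} 𝓜 τ i r =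
  Σ (Subset n) λ σ → σ ⊆ τ × ∣ σ ∣ ≡ d × i ∈ σ × M 𝓜 σ i ≡ r

IsLinkage : ∀ {n d} → MatchingField n d → Set
IsLinkage {n} {d} 𝓜 =
  ∀ (τ : Subset n) → ∣ τ ∣ ≡ suc d → IsTreeOn τ (unionMatchings 𝓜 τ)

chow : ∀ {n d} → MatchingField n d → Subset n → Graph n d
chow 𝓜 ρ = tabulate λ i → tabulate λ r →
  does (i ∈? ρ) ∧ does (M 𝓜 (∁ ρ ∪ ⁅ i ⁆) i ≟F r)

IsChowCovector : ∀ {n d} → MatchingField n d → Graph n d → Set
IsChowCovector {n} {d} 𝓜 G =
  Σ (Subset n) λ ρ → ∣ ρ ∣ ≡ n ∸ d + 1 × G ≡ chow 𝓜 ρ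

ChowCovectors : ∀ {n d} → MatchingField n d → Set
ChowCovectors {n} {d} 𝓜 = Σ (Graph n d) (IsChowCovector 𝓜)

rightDegree : ∀ {n d} → Graph n d → Vec ℕ d
rightDegree {n} G = tabulate λ r →
  length (filter (λ i → Data.Bool._≟_ (lookup (lookup G i) r) true) (allFin n))

LatticePoint : ℕ → ℕ → Set
LatticePoint n d = Σ (Vec ℕ d) λ v → sum v ≡ n ∸ d + 1

{-# OPTIONS --safe #-}
module Submission where

-- Write A = L ∖ ρ and view each matching M_σ as the vector of left nodes matched to r₁, …, r_d.  In a
-- linkage tree every right node has degree two, so deleting a left node orients the tree towards it
-- and two of its matchings differ along a path.  Two consequences drive the proof: every Chow
-- covector meets every matching, and any matching of the field can be turned into any other one
-- edge at a time, so that matchings with equal support on a set of left nodes agree there.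
-- Moreover Ω_ρ together with a matching M_{A+y} defines a map L → R, a tope, all of whose
-- transversals are matchings of the field.  If Ω_ρ and Ω_ρ′ had equal right degrees with ρ ≠ ρ′,
-- there would be two distinct topes with equal right degrees, and following the left nodes on which
-- they differ would give two matchings that disagree on a common support.  So the right degree
-- vector determines ρ; as C(n, d-1) also counts the lattice points, it takes all values.

open import Defs
open import Data.Bool using (Bool; true; false; if_then_else_)
import Data.Bool as Bool
open import Data.Nat using (ℕ; zero; suc; _+_; _∸_; _^_; _≤_; _<_; z<s)
open import Data.Nat.Properties hiding (_≟_; suc-injective)
open import Data.Nat.Induction using (<-wellFounded)
open import Induction.WellFounded using (Acc; acc)
open import Data.Fin using (Fin; zero; suc; toℕ; fromℕ<; inject₁; funToFin; finToFun)
open import Data.Fin.Properties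
  using (_≟_; any?; pigeonhole; toℕ-injective; toℕ<n; toℕ-inject₁; toℕ-fromℕ; toℕ-fromℕ<;
         finToFun-funToFin; suc-injective)
open import Data.Fin.Subset
open import Data.Fin.Subset.Properties
open import Data.Vec using (Vec; []; _∷_; lookup; tabulate; sum; here; there; _[_]≔_)
open import Data.Vec.Properties
  using (lookup∘tabulate; tabulate∘lookup; tabulate-cong; []=⇒lookup; lookup⇒[]=; []≔-commutes;
         []≔-idempotent; []≔-updates; []≔-minimal; []≔-lookup; lookup∘update; lookup∘update′)
open import Data.List using (length; filter)
import Data.List as List
open import Data.Product using (Σ; ∃-syntax; _×_; _,_; proj₁; proj₂)
open import Data.Sum using (_⊎_; inj₁; inj₂)
open import Data.Unit using (tt) renaming (⊤ to Unit)
open import Function using (_∘_; id; case_of_; _∋_)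
open import Relation.Nullary using (¬_; Dec; yes; no; does; contradiction; ¬?)
open import Relation.Nullary.Decidable using (_×-dec_; dec-true; decidable-stable)
open import Relation.Unary using (Decidable)
open import Relation.Binary.PropositionalEquality
open import Relation.Binary.Definitions using (tri<; tri≈; tri>)

-- Adding and removing single elements of a finite set.

infixl 6 _⊕_ _⊖_

_⊕_ _⊖_ : ∀ {n} → Subset n → Fin n → Subset n
p ⊕ x = p [ x ]≔ inside
p ⊖ x = p [ x ]≔ outside

∉⇒lookup : ∀ {n} {p : Subset n} {x} → x ∉ p → lookup p x ≡ outside
∉⇒lookup {p = p} {x} x∉p with lookup p x in eq
... | true  = contradiction (lookup⇒[]= x p eq) x∉p
... | false = refl

lookup⇒∉ : ∀ {n} {p : Subset n} {x} → lookup p x ≡ outside → x ∉ p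
lookup⇒∉ eq x∈p with () ← trans (sym ([]=⇒lookup x∈p)) eq

x∈p⊕x : ∀ {n} (p : Subset n) x → x ∈ p ⊕ x
x∈p⊕x = []≔-updates

p⊆p⊕x : ∀ {n} {p : Subset n} {x} → p ⊆ p ⊕ x
p⊆p⊕x {p = p} {x} {y} y∈p with y ≟ x
... | yes refl = x∈p⊕x p x
... | no y≢x   = []≔-minimal p y x y≢x y∈p

∈-⊕⁻ : ∀ {n} {p : Subset n} {x y} → y ∈ p ⊕ x → y ≢ x → y ∈ p
∈-⊕⁻ {p = p} {x} {y} y∈ y≢x =
  lookup⇒[]= y p (trans (sym (lookup∘update′ y≢x p inside)) ([]=⇒lookup y∈))

x∉p⊖x : ∀ {n} (p : Subset n) x → x ∉ p ⊖ x
x∉p⊖x p x = lookup⇒∉ (lookup∘update x p outside)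

∈-⊖⁺ : ∀ {n} {p : Subset n} {x y} → y ∈ p → y ≢ x → y ∈ p ⊖ x
∈-⊖⁺ {p = p} {x} {y} y∈ y≢x = []≔-minimal p y x y≢x y∈

p⊖x⊆p : ∀ {n} {p : Subset n} {x} → p ⊖ x ⊆ p
p⊖x⊆p {p = p} {x} {y} y∈ with y ≟ x
... | yes refl = contradiction y∈ (x∉p⊖x p x)
... | no y≢x   = lookup⇒[]= y p (trans (sym (lookup∘update′ y≢x p outside)) ([]=⇒lookup y∈))

∈-⊖⇒≢ : ∀ {n} {p : Subset n} {x y} → y ∈ p ⊖ x → y ≢ x
∈-⊖⇒≢ {p = p} {x} y∈ refl = x∉p⊖x p x y∈

⊕-⊖-cancel : ∀ {n} {p : Subset n} {x} → x ∉ p → p ⊕ x ⊖ x ≡ p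
⊕-⊖-cancel {p = p} {x} x∉p = trans ([]≔-idempotent p x)
  (trans (cong (p [ x ]≔_) (sym (∉⇒lookup x∉p))) ([]≔-lookup p x))

⊖-⊕-cancel : ∀ {n} {p : Subset n} {x} → x ∈ p → p ⊖ x ⊕ x ≡ p
⊖-⊕-cancel {p = p} {x} x∈p = trans ([]≔-idempotent p x)
  (trans (cong (p [ x ]≔_) (sym ([]=⇒lookup x∈p))) ([]≔-lookup p x))

⊕-⊖-comm : ∀ {n} {p : Subset n} {x y} → x ≢ y → p ⊕ x ⊖ y ≡ p ⊖ y ⊕ x
⊕-⊖-comm {p = p} {x} {y} x≢y = []≔-commutes p x y x≢y

⊕-comm : ∀ {n} {p : Subset n} x y → p ⊕ x ⊕ y ≡ p ⊕ y ⊕ x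
⊕-comm {p = p} x y with x ≟ y
... | yes refl = refl
... | no x≢y   = []≔-commutes p x y x≢y

⊕-⊕-⊖-cancel : ∀ {n} {p : Subset n} {x y} → x ∉ p → x ≢ y → p ⊕ x ⊕ y ⊖ x ≡ p ⊕ y
⊕-⊕-⊖-cancel {y = y} x∉p x≢y =
  trans (⊕-⊖-comm (x≢y ∘ sym)) (cong (_⊕ y) (⊕-⊖-cancel x∉p))

∣p⊕x∣ : ∀ {n} {p : Subset n} {x} → x ∉ p → ∣ p ⊕ x ∣ ≡ suc ∣ p ∣
∣p⊕x∣ {p = p} x∉p = go p _ (∉⇒lookup x∉p)
  where
  go : ∀ {n} (p : Subset n) x → lookup p x ≡ outside → ∣ p ⊕ x ∣ ≡ suc ∣ p ∣
  go (false ∷ p) zero    eq = refl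
  go (true  ∷ p) (suc x) eq = cong suc (go p x eq)
  go (false ∷ p) (suc x) eq = go p x eq

∣p⊖x∣ : ∀ {n} {p : Subset n} {x} → x ∈ p → suc ∣ p ⊖ x ∣ ≡ ∣ p ∣
∣p⊖x∣ {p = p} {x} x∈p = trans (sym (∣p⊕x∣ (x∉p⊖x p x))) (cong ∣_∣ (⊖-⊕-cancel x∈p))

∪-⁅⁆ : ∀ {n} (p : Subset n) x → p ∪ ⁅ x ⁆ ≡ p ⊕ x
∪-⁅⁆ p x = ⊆-antisym to from
  where
  to : p ∪ ⁅ x ⁆ ⊆ p ⊕ x
  to y∈ with x∈p∪q⁻ p ⁅ x ⁆ y∈
  ... | inj₁ y∈p = p⊆p⊕x y∈p
  ... | inj₂ y∈x with refl ← x∈⁅y⁆⇒x≡y x y∈x = x∈p⊕x p x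
  from : p ⊕ x ⊆ p ∪ ⁅ x ⁆
  from {y} y∈ with y ≟ x
  ... | yes refl = x∈p∪q⁺ (inj₂ (x∈⁅x⁆ x))
  ... | no y≢x   = x∈p∪q⁺ (inj₁ (∈-⊕⁻ y∈ y≢x))

-- Decidable subsets, comparison of sizes, enumeration.

⟦_⟧ : ∀ {n} {P : Fin n → Set} → Decidable P → Subset n
⟦ P? ⟧ = tabulate (does ∘ P?)

∈-⟦⟧⁺ : ∀ {n} {P : Fin n → Set} (P? : Decidable P) {x} → P x → x ∈ ⟦ P? ⟧
∈-⟦⟧⁺ P? {x} px = lookup⇒[]= x _ (trans (lookup∘tabulate _ x) (dec-true (P? x) px))

∈-⟦⟧⁻ : ∀ {n} {P : Fin n → Set} (P? : Decidable P) {x} → x ∈ ⟦ P? ⟧ → P x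
∈-⟦⟧⁻ P? {x} x∈ with P? x in eq
... | yes px = px
... | no _ with () ← trans (sym ([]=⇒lookup x∈)) (trans (lookup∘tabulate _ x) (cong does eq))

⊆∧∣∣≤⇒≡ : ∀ {n} {p q : Subset n} → p ⊆ q → ∣ q ∣ ≤ ∣ p ∣ → p ≡ q
⊆∧∣∣≤⇒≡ {p = p} {q} p⊆q q≤p with any? (λ x → (x ∈? q) ×-dec ¬? (x ∈? p))
... | yes (x , x∈q , x∉p) = contradiction q≤p (<⇒≱ (p⊂q⇒∣p∣<∣q∣ (p⊆q , x , x∈q , x∉p)))
... | no ¬∃ = ⊆-antisym p⊆q λ {x} x∈q →
  decidable-stable (x ∈? p) λ x∉p → ¬∃ (x , x∈q , x∉p)

∣∣<⇒∃∈∖ : ∀ {n} {p q : Subset n} → ∣ p ∣ < ∣ q ∣ → ∃[ x ] x ∈ q × x ∉ p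
∣∣<⇒∃∈∖ {p = p} {q} p<q with any? (λ x → (x ∈? q) ×-dec ¬? (x ∈? p))
... | yes found = found
... | no ¬∃ = contradiction (p⊆q⇒∣p∣≤∣q∣ {p = q} {q = p} λ {x} x∈q →
  decidable-stable (x ∈? p) λ x∉p → ¬∃ (x , x∈q , x∉p)) (<⇒≱ p<q)

∣∣>0⇒Nonempty : ∀ {n} (p : Subset n) → 0 < ∣ p ∣ → Nonempty p
∣∣>0⇒Nonempty {n} p 0<p with x , x∈p , _ ← ∣∣<⇒∃∈∖ {p = ⊥} {q = p} (subst (_< ∣ p ∣) (sym (∣⊥∣≡0 n)) 0<p) = x , x∈p
∈⇒∣∣>0 : ∀ {n} {p : Subset n} {x} → x ∈ p → 0 < ∣ p ∣
∈⇒∣∣>0 x∈p = subst (0 <_) (∣p⊖x∣ x∈p) z<s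

enumerate : ∀ {n} (p : Subset n) → Fin ∣ p ∣ → Fin n
enumerate (true  ∷ p) zero    = zero
enumerate (true  ∷ p) (suc i) = suc (enumerate p i)
enumerate (false ∷ p) i       = suc (enumerate p i)

enumerate-∈ : ∀ {n} (p : Subset n) i → enumerate p i ∈ p
enumerate-∈ (true  ∷ p) zero    = here
enumerate-∈ (true  ∷ p) (suc i) = there (enumerate-∈ p i)
enumerate-∈ (false ∷ p) i       = there (enumerate-∈ p i)

enumerate-injective : ∀ {n} (p : Subset n) {i j} → enumerate p i ≡ enumerate p j → i ≡ j
enumerate-injective (true  ∷ p) {zero}  {zero}  eq = refl
enumerate-injective (true  ∷ p) {suc i} {suc j} eq =
  cong suc (enumerate-injective p (suc-injective eq))
enumerate-injective (false ∷ p) eq = enumerate-injective p (suc-injective eq)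

-- Iteration on finite sets and closed walks in bipartite graphs.

iterate : ∀ {A : Set} → (A → A) → ℕ → A → A
iterate f zero    x = x
iterate f (suc k) x = f (iterate f k x)

iterate-+ : ∀ {A : Set} (f : A → A) j k x → iterate f (j + k) x ≡ iterate f j (iterate f k x)
iterate-+ f zero    k x = refl
iterate-+ f (suc j) k x = cong f (iterate-+ f j k x)

iterate-injective : ∀ {A : Set} {f : A → A} → (∀ {x y} → f x ≡ f y → x ≡ y) →
  ∀ k {x y} → iterate f k x ≡ iterate f k y → x ≡ y
iterate-injective inj zero    eq = eq
iterate-injective inj (suc k) eq = iterate-injective inj k (inj eq)

-- Some iterate of f returns to y.
injective⇒surjective : ∀ {A : Set} {N} (code : A → Fin N) → (∀ {x y} → code x ≡ code y → x ≡ y) →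
  ∀ {f : A → A} → (∀ {x y} → f x ≡ f y → x ≡ y) → ∀ y → ∃[ x ] f x ≡ y
injective⇒surjective {N = N} code code-inj {f} inj y
  with i , j , i<j , eq ← pigeonhole (n<1+n N) (λ i → code (iterate f (toℕ i) y))
  with k , i+k≡j ← m≤n⇒∃[o]m+o≡n i<j
  = iterate f k y , sym (iterate-injective inj (toℕ i) (begin
      iterate f (toℕ i) y                     ≡⟨ code-inj eq ⟩
      iterate f (toℕ j) y                     ≡⟨ cong (λ m → iterate f m y) (trans (sym i+k≡j) (sym (+-suc (toℕ i) k))) ⟩
      iterate f (toℕ i + suc k) y             ≡⟨ iterate-+ f (toℕ i) (suc k) y ⟩
      iterate f (toℕ i) (iterate f (suc k) y) ∎))
  where open ≡-Reasoning

module _ {d : ℕ} (f : Fin d → Fin d) where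

  periodic-point : ∀ x → ∃[ i ] ∃[ k ] iterate f (suc k) (iterate f i x) ≡ iterate f i x
  periodic-point x with i , j , i<j , eq ← pigeonhole (n<1+n d) (λ i → iterate f (toℕ i) x)
    with k , eq′ ← m≤n⇒∃[o]m+o≡n i<j =
    toℕ i , k , (begin
      iterate f (suc k) (iterate f (toℕ i) x) ≡⟨ iterate-+ f (suc k) (toℕ i) x ⟨
      iterate f (suc k + toℕ i) x             ≡⟨ cong (λ m → iterate f m x) (trans (cong suc (+-comm k (toℕ i))) eq′) ⟩
      iterate f (toℕ j) x                     ≡⟨ eq ⟨
      iterate f (toℕ i) x                     ∎)
    where open ≡-Reasoning

  minimal-period : ∀ {y} k → iterate f (suc k) y ≡ y →
    ∃[ l ] iterate f (suc l) y ≡ y × (∀ (m : Fin l) → iterate f (suc (toℕ m)) y ≢ y)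
  minimal-period {y} k = go k (<-wellFounded k)
    where
    go : ∀ k → Acc _<_ k → iterate f (suc k) y ≡ y →
      ∃[ l ] iterate f (suc l) y ≡ y × (∀ (m : Fin l) → iterate f (suc (toℕ m)) y ≢ y)
    go k (acc rs) eq with any? (λ (m : Fin k) → iterate f (suc (toℕ m)) y ≟ y)
    ... | yes (m , eq′) = go (toℕ m) (rs (toℕ<n m)) eq′
    ... | no ¬∃         = k , eq , λ m eq′ → ¬∃ (m , eq′)

  -- If iterates a < b of a point of period k agree, then b - a is a period as well.
  orbit-injective : ∀ {y k} → iterate f (suc k) y ≡ y →
    (∀ (m : Fin k) → iterate f (suc (toℕ m)) y ≢ y) →
    ∀ {a b} → a < b → b ≤ k → iterate f a y ≢ iterate f b y
  orbit-injective {y} {k} per min {a} {b} a<b b≤k eq =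
    min (fromℕ< e<k) (subst (λ m → iterate f (suc m) y ≡ y) (sym (toℕ-fromℕ< e<k)) per′)
    where
    c = k ∸ b
    e = c + a
    c+b≡k : c + b ≡ k
    c+b≡k = m∸n+n≡m b≤k
    e<k : e < k
    e<k = subst (e <_) c+b≡k (+-monoʳ-< c a<b)
    per′ : iterate f (suc e) y ≡ y
    per′ = begin
      iterate f (suc c + a) y           ≡⟨ iterate-+ f (suc c) a y ⟩
      iterate f (suc c) (iterate f a y) ≡⟨ cong (iterate f (suc c)) eq ⟩
      iterate f (suc c) (iterate f b y) ≡⟨ iterate-+ f (suc c) b y ⟨
      iterate f (suc c + b) y           ≡⟨ cong (λ m → iterate f (suc m) y) c+b≡k ⟩
      iterate f (suc k) y               ≡⟨ per ⟩
      y                                 ∎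
      where open ≡-Reasoning

  iterate-preserves : (P : Fin d → Set) → (∀ {r} → P r → P (f r)) → ∀ k {r} → P r → P (iterate f k r)
  iterate-preserves P step zero    pr = pr
  iterate-preserves P step (suc k) pr = step (iterate-preserves P step k pr)

-- Consecutive right nodes r, φ r of a walk are joined through the left node γ r; such a walk
-- closes up because R is finite.
walk⇒cycle : ∀ {n d} {E : EdgePred n d} (P : Fin d → Set) (φ : Fin d → Fin d) (γ : Fin d → Fin n) →
  (∀ {r} → P r → P (φ r)) →
  (∀ {r} → P r → E (γ r) r) →
  (∀ {r} → P r → E (γ r) (φ r)) →
  (∀ {r} → P r → φ r ≢ r) →
  (∀ {r r′} → P r → P r′ → γ r ≡ γ r′ → φ r ≡ φ r′) →
  ∀ {r} → P r → ∃[ m ] Cycle E m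
walk⇒cycle {E = E} P φ γ Pφ γ-r γ-φr φ≢ φ-γ {r} Pr
  with i , k₀ , per₀ ← periodic-point φ r
  with minimal-period φ k₀ per₀
... | zero  , per , min = contradiction per (φ≢ (iterate-preserves φ P Pφ i Pr))
... | suc m , per , min = m , record
  { a = a ; b = b
  ; a-inj = λ s t eq → b-inj s t (trans (sym (φ-pred s)) (trans (φ-γ (P-pred s) (P-pred t) eq) (φ-pred t)))
  ; b-inj = b-inj
  ; e-ab = λ s → subst (E (a s)) (φ-pred s) (γ-φr (P-pred s))
  ; e-ba = λ s → subst (λ x → E x (b (inject₁ s))) (sym (a-suc s)) (γ-r (P-b (inject₁ s)))
  ; e-close = subst (λ x → E (a zero) (c x)) (sym (toℕ-fromℕ (suc m))) (γ-r (P-pred zero))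
  }
  where
  y = iterate φ i r
  c : ℕ → _
  c s = iterate φ s y
  P-c : ∀ s → P (c s)
  P-c s = iterate-preserves φ P Pφ s (iterate-preserves φ P Pφ i Pr)
  periodic : ∀ s → c (s + suc (suc m)) ≡ c s
  periodic s = trans (iterate-+ φ s (suc (suc m)) y) (cong (iterate φ s) per)
  -- Adding `suc m` goes one step back on an orbit of period `suc (suc m)`, so `a s` is the left
  -- node that joins `b s` to its predecessor.
  pred : Fin (suc (suc m)) → _
  pred s = c (toℕ s + suc m)
  P-pred : ∀ s → P (pred s)
  P-pred s = P-c (toℕ s + suc m)
  b : Fin (suc (suc m)) → _
  b s = c (toℕ s)
  P-b : ∀ s → P (b s)
  P-b s = P-c (toℕ s)
  a : Fin (suc (suc m)) → _
  a s = γ (pred s)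
  φ-pred : ∀ s → φ (pred s) ≡ b s
  φ-pred s = trans (cong c (sym (+-suc (toℕ s) (suc m)))) (periodic (toℕ s))
  a-suc : ∀ s → a (suc s) ≡ γ (b (inject₁ s))
  a-suc s = cong γ (trans (cong c (sym (+-suc (toℕ s) (suc m))))
    (trans (periodic (toℕ s)) (cong c (sym (toℕ-inject₁ s)))))
  b-inj : ∀ s t → b s ≡ b t → s ≡ t
  b-inj s t eq with <-cmp (toℕ s) (toℕ t)
  ... | tri< s<t _ _ = contradiction eq (orbit-injective φ per min s<t (≤-pred (toℕ<n t)))
  ... | tri≈ _ s≡t _ = toℕ-injective s≡t
  ... | tri> _ _ t<s = contradiction (sym eq) (orbit-injective φ per min t<s (≤-pred (toℕ<n s)))

-- Codes of subsets, degree sums, stars and bars.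

subset-code : ∀ {n} → Subset n → Fin (2 ^ n)
subset-code p = funToFin (λ i → if lookup p i then zero else suc zero)

subset-code-injective : ∀ {n} {p q : Subset n} → subset-code p ≡ subset-code q → p ≡ q
subset-code-injective {p = p} {q} eq = trans (sym (tabulate∘lookup p))
  (trans (tabulate-cong λ i → bit (trans (sym (finToFun-funToFin _ i))
    (trans (cong (λ c → finToFun c i) eq) (finToFun-funToFin _ i)))) (tabulate∘lookup q))
  where
  bit : ∀ {b c : Bool} → (if b then zero else suc zero) ≡ (Fin 2 ∋ (if c then zero else suc zero)) → b ≡ c
  bit {true}  {true}  _ = refl
  bit {false} {false} _ = refl

∁-involutive : ∀ {n} (p : Subset n) → ∁ (∁ p) ≡ p
∁-involutive []          = refl
∁-involutive (true  ∷ p) = cong (true ∷_) (∁-involutive p)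
∁-involutive (false ∷ p) = cong (false ∷_) (∁-involutive p)

length-filter-≟true : ∀ {n m} (f : Fin m → Bool) (g : Fin n → Fin m) →
  length (filter (λ i → f i Bool.≟ true) (List.tabulate g)) ≡ ∣ tabulate (f ∘ g) ∣
length-filter-≟true {zero}  f g = refl
length-filter-≟true {suc n} f g with f (g zero)
... | true  = cong suc (length-filter-≟true f (g ∘ suc))
... | false = length-filter-≟true f (g ∘ suc)

indicator : Bool → ℕ
indicator b = if b then 1 else 0

∣∷∣ : ∀ {n} b (p : Subset n) → ∣ b ∷ p ∣ ≡ indicator b + ∣ p ∣
∣∷∣ true  p = refl
∣∷∣ false p = refl

sum-tabulate-+ : ∀ {d} (f g : Fin d → ℕ) →
  sum (tabulate λ r → f r + g r) ≡ sum (tabulate f) + sum (tabulate g)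
sum-tabulate-+ {zero}  f g = refl
sum-tabulate-+ {suc d} f g = trans (cong (f zero + g zero +_) (sum-tabulate-+ (f ∘ suc) (g ∘ suc)))
  (interchange (f zero) (g zero) (sum (tabulate (f ∘ suc))) (sum (tabulate (g ∘ suc))))
  where
  open import Algebra.Properties.CommutativeSemigroup +-commutativeSemigroup using (interchange)

sum-tabulate-0 : ∀ d → sum (tabulate {n = d} λ _ → 0) ≡ 0
sum-tabulate-0 zero    = refl
sum-tabulate-0 (suc d) = sum-tabulate-0 d

sum-indicator-≟ : ∀ {d} (x : Fin d) → sum (tabulate λ r → indicator (does (x ≟ r))) ≡ 1
sum-indicator-≟ {suc d} zero    = cong suc (sum-tabulate-0 d)
sum-indicator-≟ {suc d} (suc x) = sum-indicator-≟ x

sum-∣fibres∣ : ∀ {n d} (p : Subset n) (φ : Fin n → Fin d) →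
  sum (tabulate λ r → ∣ ⟦ (λ i → (i ∈? p) ×-dec (φ i ≟ r)) ⟧ ∣) ≡ ∣ p ∣
sum-∣fibres∣ {d = d} []          φ = sum-tabulate-0 d
sum-∣fibres∣         (false ∷ p) φ = sum-∣fibres∣ p (φ ∘ suc)
sum-∣fibres∣ {d = d} (true  ∷ p) φ = begin
  sum (tabulate λ r → ∣ does (φ zero ≟ r) ∷ fib r ∣)
    ≡⟨ cong sum (tabulate-cong λ r → ∣∷∣ (does (φ zero ≟ r)) (fib r)) ⟩
  sum (tabulate λ r → indicator (does (φ zero ≟ r)) + ∣ fib r ∣)
    ≡⟨ sum-tabulate-+ (λ r → indicator (does (φ zero ≟ r))) (λ r → ∣ fib r ∣) ⟩
  sum (tabulate λ r → indicator (does (φ zero ≟ r))) + sum (tabulate λ r → ∣ fib r ∣)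
    ≡⟨ cong₂ _+_ (sum-indicator-≟ (φ zero)) (sum-∣fibres∣ p (φ ∘ suc)) ⟩
  suc ∣ p ∣ ∎
  where
  open ≡-Reasoning
  fib : Fin d → Subset _
  fib r = ⟦ (λ i → (i ∈? p) ×-dec (φ (suc i) ≟ r)) ⟧

-- Stars and bars: the entries of v are the lengths of the runs of 'outside' separated by 'inside'.
stars-and-bars : ∀ n {d} → Vec ℕ (suc d) → Subset n
stars-and-bars zero    v              = []
stars-and-bars (suc n) (suc x ∷ v)    = outside ∷ stars-and-bars n (x ∷ v)
stars-and-bars (suc n) (zero ∷ [])    = outside ∷ stars-and-bars n (zero ∷ [])
stars-and-bars (suc n) (zero ∷ x ∷ v) = inside ∷ stars-and-bars n (x ∷ v)

∣stars-and-bars∣ : ∀ n {d} (v : Vec ℕ (suc d)) → sum v + d ≡ n → ∣ stars-and-bars n v ∣ ≡ d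
∣stars-and-bars∣ zero    {zero}  v              eq = refl
∣stars-and-bars∣ zero    {suc d} v              eq with () ← trans (sym (+-suc (sum v) d)) eq
∣stars-and-bars∣ (suc n)         (suc x ∷ v)    eq = ∣stars-and-bars∣ n (x ∷ v) (cong Data.Nat.pred eq)
∣stars-and-bars∣ (suc n) {suc d} (zero ∷ x ∷ v) eq = cong suc (∣stars-and-bars∣ n (x ∷ v)
  (cong Data.Nat.pred (trans (sym (+-suc (x + sum v) d)) eq)))

stars-and-bars-injective : ∀ n {d} (v w : Vec ℕ (suc d)) → sum v + d ≡ n → sum w + d ≡ n →
  stars-and-bars n v ≡ stars-and-bars n w → v ≡ w
stars-and-bars-injective zero {zero}  (zero ∷ []) (zero ∷ []) eq eq′ _ = refl
stars-and-bars-injective zero {suc d} v w eq _ _ with () ← trans (sym (+-suc (sum v) d)) eq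
stars-and-bars-injective (suc n) (suc x ∷ v) (suc y ∷ w) eq eq′ same
  with refl ← stars-and-bars-injective n (x ∷ v) (y ∷ w) (cong Data.Nat.pred eq) (cong Data.Nat.pred eq′)
    (cong Data.Vec.tail same) = refl
stars-and-bars-injective (suc n) {suc d} (zero ∷ x ∷ v) (zero ∷ y ∷ w) eq eq′ same =
  cong (zero ∷_) (stars-and-bars-injective n (x ∷ v) (y ∷ w)
    (cong Data.Nat.pred (trans (sym (+-suc (x + sum v) d)) eq))
    (cong Data.Nat.pred (trans (sym (+-suc (y + sum w) d)) eq′)) (cong Data.Vec.tail same))
stars-and-bars-injective (suc n) {suc d} (suc x ∷ v) (zero ∷ y ∷ w) eq eq′ ()
stars-and-bars-injective (suc n) {suc d} (zero ∷ x ∷ v) (suc y ∷ w) eq eq′ ()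

-- Matching fields through their inverse matchings.

module Matchings {n d : ℕ} (d≤n : d ≤ n) (𝓜 : MatchingField n d) (linkage : IsLinkage 𝓜) where

  private
    μ : Subset n → Fin n → Fin d
    μ = M 𝓜

  matched? : ∀ σ r → Dec (∃[ i ] i ∈ σ × μ σ i ≡ r)
  matched? σ r = any? (λ i → (i ∈? σ) ×-dec (μ σ i ≟ r))

  abstract
    -- The inverse of the matching M_σ, as a vector of left nodes indexed by R.  When ∣σ∣ ≢ d the
    -- value may be a junk default.
    O : Subset n → Fin d → Fin n
    O σ r with matched? σ r
    ... | yes (i , _) = i
    ... | no  _       = Data.Fin.inject≤ r d≤n

    -- As `σ` has size `d`, composing with `enumerate σ` gives an injective self-map of `Fin d`,
    -- hence a surjective one.
    μ-surjective : ∀ {σ} → ∣ σ ∣ ≡ d → ∀ r → ∃[ i ] i ∈ σ × μ σ i ≡ r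
    μ-surjective {σ} refl r
      with k , eq ← injective⇒surjective id id {f = μ σ ∘ enumerate σ}
        (λ {i} {j} eq → enumerate-injective σ (perfect 𝓜 σ refl _ _ (enumerate-∈ σ i) (enumerate-∈ σ j) eq)) r
      = enumerate σ k , enumerate-∈ σ k , eq

    O-spec : ∀ {σ} → ∣ σ ∣ ≡ d → ∀ r → O σ r ∈ σ × μ σ (O σ r) ≡ r
    O-spec {σ} ∣σ∣ r with matched? σ r
    ... | yes (_ , spec) = spec
    ... | no ¬∃          = contradiction (μ-surjective ∣σ∣ r) ¬∃

  O-∈ : ∀ {σ} → ∣ σ ∣ ≡ d → ∀ r → O σ r ∈ σ
  O-∈ ∣σ∣ r = proj₁ (O-spec ∣σ∣ r)

  μ-O : ∀ {σ} → ∣ σ ∣ ≡ d → ∀ r → μ σ (O σ r) ≡ r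
  μ-O ∣σ∣ r = proj₂ (O-spec ∣σ∣ r)

  O-μ : ∀ {σ} → ∣ σ ∣ ≡ d → ∀ {i} → i ∈ σ → O σ (μ σ i) ≡ i
  O-μ {σ} ∣σ∣ {i} i∈σ = perfect 𝓜 σ ∣σ∣ _ _ (O-∈ ∣σ∣ _) i∈σ (μ-O ∣σ∣ _)

  O-injective : ∀ {σ} → ∣ σ ∣ ≡ d → ∀ {r r′} → O σ r ≡ O σ r′ → r ≡ r′
  O-injective {σ} ∣σ∣ eq = trans (sym (μ-O ∣σ∣ _)) (trans (cong (μ σ) eq) (μ-O ∣σ∣ _))

  O⇒μ : ∀ {σ} → ∣ σ ∣ ≡ d → ∀ {r i} → O σ r ≡ i → μ σ i ≡ r
  O⇒μ ∣σ∣ refl = μ-O ∣σ∣ _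

  ∣⊕∣≡d : ∀ {A : Subset n} {x} → suc ∣ A ∣ ≡ d → x ∉ A → ∣ A ⊕ x ∣ ≡ d
  ∣⊕∣≡d ∣A∣ x∉A = trans (∣p⊕x∣ x∉A) ∣A∣

  -- Orientations of a linkage tree.

  module LinkageTree (τ : Subset n) (∣τ∣ : ∣ τ ∣ ≡ suc d) where

    -- In the linkage tree every right node has degree two, and `o z r` is the neighbour of `r` on
    -- the side away from `z`.
    o : Fin n → Fin d → Fin n
    o z = O (τ ⊖ z)

    ∣τ⊖∣ : ∀ {z} → z ∈ τ → ∣ τ ⊖ z ∣ ≡ d
    ∣τ⊖∣ z∈τ = cong Data.Nat.pred (trans (∣p⊖x∣ z∈τ) ∣τ∣)

    o-∈ : ∀ {z} → z ∈ τ → ∀ r → o z r ∈ τ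
    o-∈ z∈τ r = p⊖x⊆p (O-∈ (∣τ⊖∣ z∈τ) r)

    o-≢ : ∀ {z} → z ∈ τ → ∀ r → o z r ≢ z
    o-≢ z∈τ r = ∈-⊖⇒≢ (O-∈ (∣τ⊖∣ z∈τ) r)

    o-injective : ∀ {z} → z ∈ τ → ∀ {r r′} → o z r ≡ o z r′ → r ≡ r′
    o-injective z∈τ = O-injective (∣τ⊖∣ z∈τ)

    o-surjective : ∀ {z x} → z ∈ τ → x ∈ τ → x ≢ z → ∃[ r ] o z r ≡ x
    o-surjective z∈τ x∈τ x≢z = _ , O-μ (∣τ⊖∣ z∈τ) (∈-⊖⁺ x∈τ x≢z)

    Edge : EdgePred n d
    Edge = unionMatchings 𝓜 τ

    o-edge : ∀ {z} → z ∈ τ → ∀ r → Edge (o z r) r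
    o-edge {z} z∈τ r = τ ⊖ z , p⊖x⊆p , ∣τ⊖∣ z∈τ , O-∈ (∣τ⊖∣ z∈τ) r , μ-O (∣τ⊖∣ z∈τ) r

    acyclic : ∀ m → ¬ Cycle Edge m
    acyclic = proj₂ (linkage τ ∣τ∣)

    -- Besides its partner under M_{τ∖i}, every right node has a further neighbour.  Following those
    -- from r₀, starting with a j ∉ {i, M_{τ∖i}⁻¹(r₀)}, the walk must either repeat or arrive at i,
    -- and then the edge from i to r₀ closes it up.
    degree-two : ∀ {i j r₀} → i ∈ τ → Edge i r₀ → Edge j r₀ → j ≢ i → o i r₀ ≡ j
    degree-two {i} {j} {r₀} i∈τ i-r₀ j-r₀ j≢i with o i r₀ ≟ j
    ... | yes eq = eq
    ... | no ≢j = contradiction (proj₂ cyc) (acyclic (proj₁ cyc))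
      where
      g : Fin d → Fin n
      g r with r ≟ r₀
      ... | yes _ = j
      ... | no  _ = o (o i r) r
      g-edge : ∀ r → Edge (g r) r
      g-edge r with r ≟ r₀
      ... | yes refl = j-r₀
      ... | no  _    = o-edge (o-∈ i∈τ r) r
      g-≢ : ∀ r → o i r ≢ g r
      g-≢ r with r ≟ r₀
      ... | yes refl = ≢j
      ... | no  _    = o-≢ (o-∈ i∈τ r) r ∘ sym
      g-∈ : ∀ r → g r ≢ i → ∃[ r′ ] o i r′ ≡ g r
      g-∈ r ≢i with r ≟ r₀
      ... | yes refl = o-surjective i∈τ (let (_ , σ⊆τ , _ , j∈σ , _) = j-r₀ in σ⊆τ j∈σ) ≢i
      ... | no  _    = o-surjective i∈τ (o-∈ (o-∈ i∈τ r) r) ≢i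
      g-r₀ : g r₀ ≢ i
      g-r₀ with r₀ ≟ r₀
      ... | yes _ = j≢i
      ... | no r₀≢r₀ = contradiction refl r₀≢r₀
      φ′ : Fin n → Fin d
      φ′ x with x ≟ i
      ... | yes _ = r₀
      ... | no  _ = μ (τ ⊖ i) x
      φ-edge : ∀ r → Edge (g r) (φ′ (g r))
      φ-edge r with g r ≟ i
      ... | yes eq = subst (λ x → Edge x r₀) (sym eq) i-r₀
      ... | no ≢i with r′ , eq ← g-∈ r ≢i =
        subst₂ Edge eq (sym (O⇒μ (∣τ⊖∣ i∈τ) eq)) (o-edge i∈τ r′)
      φ-≢ : ∀ r → φ′ (g r) ≢ r
      φ-≢ r with g r ≟ i
      ... | yes eq = λ { refl → g-r₀ eq }
      ... | no ≢i with r′ , eq ← g-∈ r ≢i =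
        λ eq′ → g-≢ r (trans (cong (o i) (trans (sym eq′) (O⇒μ (∣τ⊖∣ i∈τ) eq))) eq)
      cyc : ∃[ m ] Cycle Edge m
      cyc = walk⇒cycle (λ _ → Unit) (φ′ ∘ g) g (λ _ → tt) (λ {r} _ → g-edge r) (λ {r} _ → φ-edge r)
        (λ {r} _ → φ-≢ r) (λ _ _ → cong φ′) {r₀} tt

    -- By `degree-two`, `r` has a single neighbour other than `o y r`.
    third-owner : ∀ {s t y r} → s ∈ τ → t ∈ τ → y ∈ τ → o s r ≢ o y r → o t r ≢ o y r → o s r ≡ o t r
    third-owner {s} {t} {y} {r} s∈τ t∈τ y∈τ s≢y t≢y with o s r ≟ o t r
    ... | yes eq = eq
    ... | no s≢t = contradiction
      (trans (sym (degree-two (o-∈ y∈τ r) (o-edge y∈τ r) (o-edge s∈τ r) s≢y))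
             (degree-two (o-∈ y∈τ r) (o-edge y∈τ r) (o-edge t∈τ r) t≢y)) s≢t

    -- If the paths from y to s and to t start differently, then y lies on the path from s to t, so
    -- each x sees y in the direction of s or of t.
    between : ∀ {s t y} → s ∈ τ → t ∈ τ → y ∈ τ → (∀ l → o s l ≡ y → o t l ≢ y) →
      ∀ r → o y r ≡ o s r ⊎ o y r ≡ o t r
    between {s} {t} {y} s∈τ t∈τ y∈τ sep r with o y r ≟ o s r | o y r ≟ o t r
    ... | yes eq | _      = inj₁ eq
    ... | no _   | yes eq = inj₂ eq
    ... | no ≢s  | no ≢t  = contradiction (proj₂ cyc) (acyclic (proj₁ cyc))
      where
      -- On the right nodes that violate the claim, `s` and `t` agree, and alternating between the
      -- matchings of `τ ⊖ s` and `τ ⊖ y` leads on to further violations; `sep` keeps this walk off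
      -- `y`.
      P : Fin d → Set
      P l = o y l ≢ o s l × o y l ≢ o t l
      φ : Fin d → Fin d
      φ l = μ (τ ⊖ y) (o s l)
      same : ∀ {l} → P l → o s l ≡ o t l
      same (≢s , ≢t) = third-owner s∈τ t∈τ y∈τ (≢s ∘ sym) (≢t ∘ sym)
      o-φ : ∀ {l} → P l → o y (φ l) ≡ o s l
      o-φ {l} Pl = O-μ (∣τ⊖∣ y∈τ) (∈-⊖⁺ (o-∈ s∈τ l) λ eq → sep l eq (trans (sym (same Pl)) eq))
      φ-≢ : ∀ {l} → P l → φ l ≢ l
      φ-≢ Pl eq = proj₁ Pl (trans (cong (o y) (sym eq)) (o-φ Pl))
      cyc : ∃[ m ] Cycle Edge m
      cyc = walk⇒cycle P φ (o s)
        (λ {l} Pl → (λ eq → φ-≢ Pl (o-injective s∈τ (trans (sym eq) (o-φ Pl))))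
                  , (λ eq → φ-≢ Pl (o-injective t∈τ (trans (sym eq) (trans (o-φ Pl) (same Pl))))))
        (λ {l} _ → o-edge s∈τ l)
        (λ {l} Pl → subst (λ x → Edge x (φ l)) (o-φ Pl) (o-edge y∈τ (φ l)))
        φ-≢
        (λ _ _ → cong (μ (τ ⊖ y)))
        (≢s , ≢t)

    -- The two neighbours of `r` are `j` and `o j r`, so the path between them crosses only `r`, and
    -- moving the root from one to the other changes no other partner; a further change would close
    -- an alternating walk.
    adjacent : ∀ {j s r} → j ∈ τ → s ∈ τ → o s r ≡ j →
      o (o j r) r ≡ j × (∀ r′ → r′ ≢ r → o (o j r) r′ ≡ o j r′)
    adjacent {j} {s} {r} j∈τ s∈τ os≡j = z↦j , agree
      where
      z = o j r
      z∈τ : z ∈ τ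
      z∈τ = o-∈ j∈τ r
      z↦j : o z r ≡ j
      z↦j = degree-two z∈τ (o-edge j∈τ r) (subst (λ x → Edge x r) os≡j (o-edge s∈τ r)) (o-≢ j∈τ r ∘ sym)
      agree : ∀ r′ → r′ ≢ r → o z r′ ≡ o j r′
      agree r′ r′≢r with o z r′ ≟ o j r′
      ... | yes eq = eq
      ... | no z≢j = contradiction (proj₂ cyc) (acyclic (proj₁ cyc))
        where
        P : Fin d → Set
        P l = o z l ≢ o j l × l ≢ r
        φ : Fin d → Fin d
        φ l = μ (τ ⊖ j) (o z l)
        o-φ : ∀ {l} → P l → o j (φ l) ≡ o z l
        o-φ {l} (_ , l≢r) = O-μ (∣τ⊖∣ j∈τ) (∈-⊖⁺ (o-∈ z∈τ l) λ eq → l≢r (o-injective z∈τ (trans eq (sym z↦j))))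
        φ-≢ : ∀ {l} → P l → φ l ≢ l
        φ-≢ Pl eq = proj₁ Pl (trans (sym (o-φ Pl)) (cong (o j) eq))
        cyc : ∃[ m ] Cycle Edge m
        cyc = walk⇒cycle P φ (o z)
          (λ {l} Pl → (λ eq → φ-≢ Pl (o-injective z∈τ (trans eq (o-φ Pl))))
                    , (λ eq → o-≢ z∈τ l (trans (sym (o-φ Pl)) (cong (o j) eq))))
          (λ {l} _ → o-edge z∈τ l)
          (λ {l} Pl → subst (λ x → Edge x (φ l)) (o-φ Pl) (o-edge j∈τ (φ l)))
          φ-≢
          (λ _ _ → cong (μ (τ ⊖ j)))
          (z≢j , r′≢r)

  -- The deleted sets are variables here, so that `A ⊕ x` can stand for `τ ⊖ y` along an equation.
  between′ : ∀ {τ S T Y : Subset n} {s t y} → ∣ τ ∣ ≡ suc d → s ∈ τ → t ∈ τ → y ∈ τ →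
    τ ⊖ s ≡ S → τ ⊖ t ≡ T → τ ⊖ y ≡ Y → (∀ l → O S l ≡ y → O T l ≢ y) →
    ∀ r → O Y r ≡ O S r ⊎ O Y r ≡ O T r
  between′ {τ = τ} ∣τ∣ s∈τ t∈τ y∈τ refl refl refl = LinkageTree.between τ ∣τ∣ s∈τ t∈τ y∈τ

  adjacent′ : ∀ {τ J S Z : Subset n} {j s z r} → ∣ τ ∣ ≡ suc d → j ∈ τ → s ∈ τ →
    τ ⊖ j ≡ J → τ ⊖ s ≡ S → τ ⊖ z ≡ Z → O S r ≡ j → O J r ≡ z →
    O Z r ≡ j × (∀ r′ → r′ ≢ r → O Z r′ ≡ O J r′)
  adjacent′ {τ = τ} ∣τ∣ j∈τ s∈τ refl refl refl os≡j refl = LinkageTree.adjacent τ ∣τ∣ j∈τ s∈τ os≡j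

  -- Common edges of covectors and matchings, and exchange of single edges.

  -- Chow covectors are indexed by A = L ∖ ρ: the covector joins each x ∉ A to μ (A ⊕ x) x.  Hit A σ
  -- says that it shares an edge with M_σ.
  Hit : Subset n → Subset n → Set
  Hit A σ = ∃[ r ] O σ r ∉ A × μ (A ⊕ O σ r) (O σ r) ≡ r

  O-∉ : ∀ {A σ : Subset n} → ∣ A ∣ < ∣ σ ∣ → ∣ σ ∣ ≡ d → ∃[ r ] O σ r ∉ A
  O-∉ {A} {σ} A<σ ∣σ∣ with x , x∈σ , x∉A ← ∣∣<⇒∃∈∖ {p = A} {q = σ} A<σ =
    μ σ x , subst (_∉ A) (sym (O-μ ∣σ∣ x∈σ)) x∉A

  -- For b ∈ A ∖ σ and a ∈ σ ∖ A the covector meets M_{σ+b-a}, by induction; if it does so in an edge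
  -- outside M_σ, the left node of that edge lies on the path from a to b in the linkage tree of σ + b,
  -- and can take the role of a.
  hit : ∀ {A σ} → suc ∣ A ∣ ≡ d → ∣ σ ∣ ≡ d → Hit A σ
  hit {A} {σ₀} ∣A∣ = go σ₀ (<-wellFounded _)
    where
    A<σ : ∀ {σ : Subset n} → ∣ σ ∣ ≡ d → ∣ A ∣ < ∣ σ ∣
    A<σ ∣σ∣ = subst (∣ A ∣ <_) (sym ∣σ∣) (≤-reflexive ∣A∣)
    exceeds : ∀ {σ} → ∣ σ ∣ ≡ d → ∃[ r ] O σ r ∉ A
    exceeds {σ} ∣σ∣ = O-∉ {A} {σ} (A<σ {σ} ∣σ∣) ∣σ∣
    hit-⊇ : ∀ {σ} → ∣ σ ∣ ≡ d → A ⊆ σ → Hit A σ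
    hit-⊇ {σ} ∣σ∣ A⊆σ = r , a∉A , trans (cong (λ p → μ p a) A⊕a≡σ) (μ-O ∣σ∣ r)
      where
      r = proj₁ (exceeds {σ} ∣σ∣)
      a = O σ r
      a∉A : a ∉ A
      a∉A = proj₂ (exceeds {σ} ∣σ∣)
      A⊕a⊆σ : A ⊕ a ⊆ σ
      A⊕a⊆σ {x} x∈ with x ≟ a
      ... | yes refl = O-∈ ∣σ∣ r
      ... | no x≢a   = A⊆σ (∈-⊕⁻ x∈ x≢a)
      A⊕a≡σ : A ⊕ a ≡ σ
      A⊕a≡σ = ⊆∧∣∣≤⇒≡ A⊕a⊆σ (≤-reflexive (trans ∣σ∣ (sym (∣⊕∣≡d ∣A∣ a∉A))))
    outside? : ∀ σ b → Dec (b ∈ A × b ∉ σ)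
    outside? σ b = (b ∈? A) ×-dec ¬? (b ∈? σ)
    go : ∀ σ → Acc _<_ ∣ A ∩ ∁ σ ∣ → ∣ σ ∣ ≡ d → Hit A σ
    go σ (acc rs) ∣σ∣ with any? (outside? σ)
    ... | no ¬∃ = hit-⊇ ∣σ∣ λ {x} x∈A → decidable-stable (x ∈? σ) λ x∉σ → ¬∃ (x , x∈A , x∉σ)
    ... | yes (b , b∈A , b∉σ) =
      descend (O σ r₀) (<-wellFounded _) (O-∈ ∣σ∣ r₀) (proj₂ (exceeds {σ} ∣σ∣))
      where
      r₀ = proj₁ (exceeds {σ} ∣σ∣)
      τ = σ ⊕ b
      ∣τ∣ : ∣ τ ∣ ≡ suc d
      ∣τ∣ = trans (∣p⊕x∣ b∉σ) (cong suc ∣σ∣)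
      open LinkageTree τ ∣τ∣
      τ⊖b : τ ⊖ b ≡ σ
      τ⊖b = ⊕-⊖-cancel b∉σ
      differ? : ∀ a l → Dec (o a l ≢ o b l)
      differ? a l = ¬? (o a l ≟ o b l)
      -- The inner induction is on the length of the path from `a` to `b`: exactly its right nodes
      -- are oriented differently by `a` and `b`.
      descend : ∀ a → Acc _<_ ∣ ⟦ differ? a ⟧ ∣ → a ∈ σ → a ∉ A → Hit A σ
      descend a (acc rs′) a∈σ a∉A
        = resume (go (τ ⊖ a) (rs (p⊂q⇒∣p∣<∣q∣ shrinks)) (∣τ⊖∣ (p⊆p⊕x a∈σ)))
        where
        shrinks : A ∩ ∁ (τ ⊖ a) ⊂ A ∩ ∁ σ
        shrinks = (λ {x} x∈ → let (x∈A , x∉) = x∈p∩q⁻ A _ x∈ in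
                    x∈p∩q⁺ (x∈A , x∉p⇒x∈∁p λ x∈σ → x∈∁p⇒x∉p x∉
                      (∈-⊖⁺ (p⊆p⊕x x∈σ) λ { refl → a∉A x∈A })))
                , b , x∈p∩q⁺ (b∈A , x∉p⇒x∈∁p b∉σ)
                , λ b∈ → x∈∁p⇒x∉p (proj₂ (x∈p∩q⁻ A _ b∈)) (∈-⊖⁺ (x∈p⊕x σ b) λ { refl → b∉σ a∈σ })
        resume : Hit A (τ ⊖ a) → Hit A σ
        resume (r , j∉A , eq) with O σ r ≟ o a r
        ... | yes σr≡j = r , subst (_∉ A) (sym σr≡j) j∉A , subst (λ j → μ (A ⊕ j) j ≡ r) (sym σr≡j) eq
        ... | no σr≢j = descend j (rs′ (p⊂q⇒∣p∣<∣q∣ closer)) j∈σ j∉A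
          where
          j = o a r
          a∈τ : a ∈ τ
          a∈τ = p⊆p⊕x a∈σ
          b∈τ : b ∈ τ
          b∈τ = x∈p⊕x σ b
          j∈τ : j ∈ τ
          j∈τ = o-∈ a∈τ r
          ob≢j : o b r ≢ j
          ob≢j eq′ = σr≢j (trans (cong (λ p → O p r) (sym τ⊖b)) eq′)
          j∈σ : j ∈ σ
          j∈σ = ∈-⊕⁻ j∈τ λ j≡b → j∉A (subst (_∈ A) (sym j≡b) b∈A)
          btw : ∀ l → o j l ≡ o a l ⊎ o j l ≡ o b l
          btw = between a∈τ b∈τ j∈τ λ l oa≡j → case o-injective a∈τ oa≡j of λ { refl → ob≢j }
          closer : ⟦ differ? j ⟧ ⊂ ⟦ differ? a ⟧
          closer = (λ {l} l∈ → ∈-⟦⟧⁺ (differ? a) λ oa≡ob → case btw l of λ where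
                      (inj₁ oj≡oa) → ∈-⟦⟧⁻ (differ? j) l∈ (trans oj≡oa oa≡ob)
                      (inj₂ oj≡ob) → ∈-⟦⟧⁻ (differ? j) l∈ oj≡ob)
                 , r , ∈-⟦⟧⁺ (differ? a) (ob≢j ∘ sym)
                 , λ r∈ → case btw r of λ where
                      (inj₁ oj≡oa) → o-≢ j∈τ r oj≡oa
                      (inj₂ oj≡ob) → ∈-⟦⟧⁻ (differ? j) r∈ oj≡ob

  -- Delete from `c` the partner of `r` and apply `hit` to the rest: the shared edge brings a node
  -- `j` of `t`, which is not the deleted one because `c` and `t` differ at `r`. In the linkage tree
  -- of `c ⊕ j`, `j` then displaces the partner of `r₁`.
  exchange : ∀ {c t} → ∣ c ∣ ≡ d → ∣ t ∣ ≡ d → ∀ {r} → O c r ≢ O t r →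
    ∃[ r₁ ] ∃[ c′ ] O t r₁ ∉ c × ∣ c′ ∣ ≡ d × O c′ r₁ ≡ O t r₁ × (∀ l → l ≢ r₁ → O c′ l ≡ O c l)
  exchange {c} {t} ∣c∣ ∣t∣ {r} c≢t
    with r₁ , j∉A , eq ← hit {A = c ⊖ O c r} {σ = t} (trans (∣p⊖x∣ (O-∈ {c} ∣c∣ r)) ∣c∣) ∣t∣
    = r₁ , τ ⊖ z , j∉c , LinkageTree.∣τ⊖∣ τ ∣τ∣ (p⊆p⊕x (O-∈ ∣c∣ r₁)) , adj
    where
    s = O c r
    A = c ⊖ s
    j = O t r₁
    z = O c r₁
    s∈c : s ∈ c
    s∈c = O-∈ ∣c∣ r
    ∣A∣ : suc ∣ A ∣ ≡ d
    ∣A∣ = trans (∣p⊖x∣ s∈c) ∣c∣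
    j≢s : j ≢ s
    j≢s j≡s = c≢t (trans (sym j≡s) (cong (O t) r₁≡r))
      where
      r₁≡r : r₁ ≡ r
      r₁≡r = trans (sym eq) (trans (cong (λ x → μ (A ⊕ x) x) j≡s)
        (trans (cong (λ p → μ p s) (⊖-⊕-cancel s∈c)) (μ-O ∣c∣ r)))
    j∉c : j ∉ c
    j∉c j∈c = j∉A (∈-⊖⁺ j∈c j≢s)
    τ = c ⊕ j
    ∣τ∣ : ∣ τ ∣ ≡ suc d
    ∣τ∣ = trans (∣p⊕x∣ j∉c) (cong suc ∣c∣)
    τ⊖s : τ ⊖ s ≡ A ⊕ j
    τ⊖s = ⊕-⊖-comm j≢s
    adj : O (τ ⊖ z) r₁ ≡ j × (∀ l → l ≢ r₁ → O (τ ⊖ z) l ≡ O c l)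
    adj = adjacent′ {z = z} ∣τ∣ (x∈p⊕x c j) (p⊆p⊕x s∈c) (⊕-⊖-cancel j∉c) τ⊖s refl
      (subst (λ x → O (A ⊕ j) x ≡ j) eq (O-μ (∣⊕∣≡d ∣A∣ j∉A) (x∈p⊕x A j))) refl

  -- Exchanges turn c into t without ever touching the common support.
  support-determines : ∀ {c t} → ∣ c ∣ ≡ d → ∣ t ∣ ≡ d → (P : Fin d → Set) →
    (∀ {r} → P r → ∃[ r′ ] P r′ × O c r′ ≡ O t r) → ∀ {r} → P r → O c r ≡ O t r
  support-determines {c₀} {t} ∣c₀∣ ∣t∣ P = go c₀ (<-wellFounded _) ∣c₀∣
    where
    differ? : ∀ c l → Dec (O c l ≢ O t l)
    differ? c l = ¬? (O c l ≟ O t l)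
    go : ∀ c → Acc _<_ ∣ ⟦ differ? c ⟧ ∣ → ∣ c ∣ ≡ d →
      (∀ {r} → P r → ∃[ r′ ] P r′ × O c r′ ≡ O t r) → ∀ {r} → P r → O c r ≡ O t r
    go c (acc rs) ∣c∣ closed {r} Pr with O c r ≟ O t r
    ... | yes eq = eq
    ... | no c≢t with r₁ , c′ , j∉c , ∣c′∣ , at-r₁ , off-r₁ ← exchange ∣c∣ ∣t∣ c≢t
      = trans (sym (on-P Pr)) (go c′ (rs (p⊂q⇒∣p∣<∣q∣ fewer)) ∣c′∣
          (λ Pl → let (l′ , Pl′ , eq) = closed Pl in l′ , Pl′ , trans (on-P Pl′) eq) Pr)
      where
      -- `exchange` inserts a node outside `c`, while `closed` keeps `O t l` in `c` whenever `P l`;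
      -- so `r₁` is outside `P`.
      on-P : ∀ {l} → P l → O c′ l ≡ O c l
      on-P {l} Pl = off-r₁ l λ { refl → let (l′ , _ , eq) = closed Pl in
        j∉c (subst (_∈ c) eq (O-∈ ∣c∣ l′)) }
      fewer : ⟦ differ? c′ ⟧ ⊂ ⟦ differ? c ⟧
      fewer = (λ {l} l∈ → ∈-⟦⟧⁺ (differ? c) λ eq → case l ≟ r₁ of λ where
                (yes refl) → ∈-⟦⟧⁻ (differ? c′) l∈ at-r₁
                (no l≢r₁)  → ∈-⟦⟧⁻ (differ? c′) l∈ (trans (off-r₁ l l≢r₁) eq))
            , r₁ , ∈-⟦⟧⁺ (differ? c) (λ eq → j∉c (subst (_∈ c) eq (O-∈ ∣c∣ r₁)))
            , λ r₁∈ → ∈-⟦⟧⁻ (differ? c′) r₁∈ at-r₁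

  -- Matchings with a common part `A`: sectors and crossings.

  O-last : ∀ {A x} → suc ∣ A ∣ ≡ d → x ∉ A → O (A ⊕ x) (μ (A ⊕ x) x) ≡ x
  O-last {A} {x} ∣A∣ x∉A = O-μ (∣⊕∣≡d ∣A∣ x∉A) (x∈p⊕x A x)

  -- In the linkage tree of A + x + y, the nodes x and y see each other through the right nodes
  -- μ (A ⊕ x) x and μ (A ⊕ y) y.
  same-sector : ∀ {A x y} → suc ∣ A ∣ ≡ d → x ∉ A → y ∉ A → μ (A ⊕ x) x ≡ μ (A ⊕ y) y →
    ∀ l → l ≢ μ (A ⊕ y) y → O (A ⊕ x) l ≡ O (A ⊕ y) l
  same-sector {A} {x} {y} ∣A∣ x∉A y∉A eq l l≢ with x ≟ y
  ... | yes refl = refl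
  ... | no x≢y = sym (proj₂ (adjacent′ {z = x} (trans (∣p⊕x∣ y∉A⊕x) (cong suc (∣⊕∣≡d ∣A∣ x∉A)))
      (x∈p⊕x (A ⊕ x) y) (p⊆p⊕x (x∈p⊕x A x)) (⊕-⊖-cancel y∉A⊕x) τ⊖x τ⊖x
      (O-last ∣A∣ y∉A) (trans (cong (O (A ⊕ x)) (sym eq)) (O-last ∣A∣ x∉A))) l l≢)
    where
    y∉A⊕x : y ∉ A ⊕ x
    y∉A⊕x y∈ = y∉A (∈-⊕⁻ y∈ (x≢y ∘ sym))
    τ⊖x : A ⊕ x ⊕ y ⊖ x ≡ A ⊕ y
    τ⊖x = ⊕-⊕-⊖-cancel x∉A x≢y

  -- In the linkage tree of `A + x + y` the neighbours of `μ (A ⊕ y) y` are `y` and `a`; deleting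
  -- `a` instead of `y` changes only its partner.
  swap : ∀ {A x y a} → suc ∣ A ∣ ≡ d → x ∉ A → y ∉ A → x ≢ y → a ≢ x → a ≢ y →
    O (A ⊕ x) (μ (A ⊕ y) y) ≡ a →
    O (A ⊖ a ⊕ y ⊕ x) (μ (A ⊕ y) y) ≡ y ×
    (∀ l → l ≢ μ (A ⊕ y) y → O (A ⊖ a ⊕ y ⊕ x) l ≡ O (A ⊕ x) l)
  swap {A} {x} {y} {a} ∣A∣ x∉A y∉A x≢y a≢x a≢y eq =
    adjacent′ {z = a} (trans (∣p⊕x∣ y∉A⊕x) (cong suc (∣⊕∣≡d ∣A∣ x∉A)))
      (x∈p⊕x (A ⊕ x) y) (p⊆p⊕x (x∈p⊕x A x)) (⊕-⊖-cancel y∉A⊕x) (⊕-⊕-⊖-cancel x∉A x≢y)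
      (trans (⊕-⊖-comm (a≢y ∘ sym)) (trans (cong (_⊕ y) (⊕-⊖-comm (a≢x ∘ sym))) (⊕-comm x y)))
      (O-last ∣A∣ y∉A) eq
    where
    y∉A⊕x : y ∉ A ⊕ x
    y∉A⊕x y∈ = y∉A (∈-⊕⁻ y∈ (x≢y ∘ sym))

  -- Replacing a ∈ A by y₁, which M_{A+y₀} permits at the right node q₁, can move y₂ out of its
  -- sector only if M_{A+y₂} differs from M_{A+y₀} in strictly more right nodes than M_{A+y₁} does.
  module Crossing {A : Subset n} {y₀ y₁ y₂ : Fin n} (∣A∣ : suc ∣ A ∣ ≡ d)
    (y₀∉A : y₀ ∉ A) (y₁∉A : y₁ ∉ A) (y₂∉A : y₂ ∉ A)
    (q₁≢q₀ : μ (A ⊕ y₁) y₁ ≢ μ (A ⊕ y₀) y₀)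
    (q₂≢q₀ : μ (A ⊕ y₂) y₂ ≢ μ (A ⊕ y₀) y₀)
    (q₁≢q₂ : μ (A ⊕ y₁) y₁ ≢ μ (A ⊕ y₂) y₂) where

    private
      q₁ = μ (A ⊕ y₁) y₁
      q₂ = μ (A ⊕ y₂) y₂
      p  = O (A ⊕ y₀)
      m₁ = O (A ⊕ y₁)
      m₂ = O (A ⊕ y₂)
      a  = p q₁
      B  = A ⊖ a
      -- `N` lives in the linkage tree of `A + y₁ + y₂` along with `m₁` and `m₂`, and `Q` in that of
      -- `A + y₀ + y₂` along with `p` and `m₂`; both omit `a`.
      N  = O (B ⊕ y₁ ⊕ y₂)
      Q  = O (B ⊕ y₀ ⊕ y₂)

      y₀≢y₁ : y₀ ≢ y₁
      y₀≢y₁ refl = q₁≢q₀ refl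
      y₀≢y₂ : y₀ ≢ y₂
      y₀≢y₂ refl = q₂≢q₀ refl
      y₁≢y₂ : y₁ ≢ y₂
      y₁≢y₂ refl = q₁≢q₂ refl

      ∣⊕⊕∣ : ∀ {C : Subset n} {x y} → suc ∣ C ∣ ≡ d → x ∉ C → y ∉ C → x ≢ y → ∣ C ⊕ x ⊕ y ∣ ≡ suc d
      ∣⊕⊕∣ ∣C∣ x∉C y∉C x≢y =
        trans (∣p⊕x∣ λ y∈ → y∉C (∈-⊕⁻ y∈ (x≢y ∘ sym))) (cong suc (∣⊕∣≡d ∣C∣ x∉C))

      p-injective : ∀ {r r′} → p r ≡ p r′ → r ≡ r′
      p-injective = O-injective (∣⊕∣≡d ∣A∣ y₀∉A)
      m₁-injective : ∀ {r r′} → m₁ r ≡ m₁ r′ → r ≡ r′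
      m₁-injective = O-injective (∣⊕∣≡d ∣A∣ y₁∉A)
      m₂-injective : ∀ {r r′} → m₂ r ≡ m₂ r′ → r ≡ r′
      m₂-injective = O-injective (∣⊕∣≡d ∣A∣ y₂∉A)
      m₁-q₁ : m₁ q₁ ≡ y₁
      m₁-q₁ = O-last ∣A∣ y₁∉A
      m₂-q₂ : m₂ q₂ ≡ y₂
      m₂-q₂ = O-last ∣A∣ y₂∉A

      p≢ : ∀ {x} l → x ∉ A → x ≢ y₀ → p l ≢ x
      p≢ l x∉A x≢y₀ eq = x∉A (∈-⊕⁻ (subst (_∈ A ⊕ y₀) eq (O-∈ (∣⊕∣≡d ∣A∣ y₀∉A) l)) x≢y₀)
      m₁≢ : ∀ {x} l → x ∉ A → x ≢ y₁ → m₁ l ≢ x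
      m₁≢ l x∉A x≢y₁ eq = x∉A (∈-⊕⁻ (subst (_∈ A ⊕ y₁) eq (O-∈ (∣⊕∣≡d ∣A∣ y₁∉A) l)) x≢y₁)
      m₂≢ : ∀ {x} l → x ∉ A → x ≢ y₂ → m₂ l ≢ x
      m₂≢ l x∉A x≢y₂ eq = x∉A (∈-⊕⁻ (subst (_∈ A ⊕ y₂) eq (O-∈ (∣⊕∣≡d ∣A∣ y₂∉A) l)) x≢y₂)

      a∈A : a ∈ A
      a∈A = ∈-⊕⁻ (O-∈ (∣⊕∣≡d ∣A∣ y₀∉A) q₁) λ a≡y₀ →
        q₁≢q₀ (sym (O⇒μ (∣⊕∣≡d ∣A∣ y₀∉A) a≡y₀))
      ≢a : ∀ {x} → x ∉ A → a ≢ x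
      ≢a x∉A refl = x∉A a∈A
      a∉B : a ∉ B
      a∉B = x∉p⊖x A a
      ∉B : ∀ {x} → x ∉ A → x ∉ B
      ∉B x∉A = x∉A ∘ p⊖x⊆p
      ∣B⊕∣ : ∀ {x} → x ∉ A → suc ∣ B ⊕ x ∣ ≡ d
      ∣B⊕∣ x∉A = trans (cong suc (trans (∣p⊕x∣ (∉B x∉A)) (∣p⊖x∣ a∈A))) ∣A∣
      ⊖a : ∀ {x y} → x ∉ A → y ∉ A → A ⊕ x ⊕ y ⊖ a ≡ B ⊕ x ⊕ y
      ⊖a {x} {y} x∉A y∉A = trans (⊕-⊖-comm (≢a y∉A ∘ sym)) (cong (_⊕ y) (⊕-⊖-comm (≢a x∉A ∘ sym)))
      y∉B⊕ : ∀ {x y} → y ∉ A → x ≢ y → y ∉ B ⊕ x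
      y∉B⊕ y∉A x≢y y∈ = ∉B y∉A (∈-⊕⁻ y∈ (x≢y ∘ sym))
      ∣B⊕⊕∣ : ∀ {x y} → x ∉ A → y ∉ A → x ≢ y → ∣ B ⊕ x ⊕ y ∣ ≡ d
      ∣B⊕⊕∣ x∉A y∉A x≢y = ∣⊕∣≡d (∣B⊕∣ x∉A) (y∉B⊕ y∉A x≢y)
      Q-injective : ∀ {r r′} → Q r ≡ Q r′ → r ≡ r′
      Q-injective = O-injective (∣B⊕⊕∣ y₀∉A y₂∉A y₀≢y₂)
      N≢a : ∀ l → N l ≢ a
      N≢a l eq = a∉B (∈-⊕⁻ (∈-⊕⁻ (subst (_∈ B ⊕ y₁ ⊕ y₂) eq (O-∈ (∣B⊕⊕∣ y₁∉A y₂∉A y₁≢y₂) l))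
        (≢a y₂∉A)) (≢a y₁∉A))
      Q-surjective : ∀ {x} → x ∈ B ⊕ y₀ ⊕ y₂ → ∃[ l ] Q l ≡ x
      Q-surjective x∈ = _ , O-μ (∣B⊕⊕∣ y₀∉A y₂∉A y₀≢y₂) x∈

    module _ (crossed : μ (B ⊕ y₁ ⊕ y₂) y₂ ≢ q₂) where
      private
        N-q₂ : N q₂ ≢ y₂
        N-q₂ eq = crossed (O⇒μ (∣B⊕⊕∣ y₁∉A y₂∉A y₁≢y₂) eq)

        -- `crossed` places `y₂` between `y₁` and `a` in the linkage tree of `A + y₁ + y₂`.
        m₁-cases : ∀ l → m₁ l ≡ m₂ l ⊎ m₁ l ≡ N l
        m₁-cases = between′ (∣⊕⊕∣ ∣A∣ y₁∉A y₂∉A y₁≢y₂)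
          (p⊆p⊕x (x∈p⊕x A y₁)) (p⊆p⊕x (p⊆p⊕x a∈A)) (x∈p⊕x _ y₂)
          (⊕-⊕-⊖-cancel y₁∉A y₁≢y₂) (⊖a y₁∉A y₂∉A)
          (⊕-⊖-cancel λ y∈ → y₂∉A (∈-⊕⁻ y∈ (y₁≢y₂ ∘ sym)))
          λ l m₂l≡y₂ Nl≡y₂ → N-q₂ (trans (cong N (m₂-injective (trans m₂-q₂ (sym m₂l≡y₂)))) Nl≡y₂)

        m₂-q₁ : m₂ q₁ ≢ a
        m₂-q₁ eq with l , m₁l≡a ← (_ , O-μ (∣⊕∣≡d ∣A∣ y₁∉A) (p⊆p⊕x a∈A)) with m₁-cases l
        ... | inj₁ m₁l≡m₂l = ≢a y₁∉A (trans (sym m₁l≡a) (trans (cong m₁ l≡q₁) m₁-q₁))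
          where
          l≡q₁ : l ≡ q₁
          l≡q₁ = m₂-injective (trans (sym m₁l≡m₂l) (trans m₁l≡a (sym eq)))
        ... | inj₂ m₁l≡Nl = N≢a l (trans (sym m₁l≡Nl) m₁l≡a)

        -- By `m₂-q₁`, `a` lies between `y₀` and `y₂` in the linkage tree of `A + y₀ + y₂`.
        Q-cases : ∀ l → Q l ≡ m₂ l ⊎ Q l ≡ p l
        Q-cases = between′ (∣⊕⊕∣ ∣A∣ y₀∉A y₂∉A y₀≢y₂)
          (p⊆p⊕x (x∈p⊕x A y₀)) (x∈p⊕x _ y₂) (p⊆p⊕x (p⊆p⊕x a∈A))
          (⊕-⊕-⊖-cancel y₀∉A y₀≢y₂)
          (⊕-⊖-cancel λ y∈ → y₂∉A (∈-⊕⁻ y∈ (y₀≢y₂ ∘ sym)))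
          (⊖a y₀∉A y₂∉A)
          λ l m₂l≡a pl≡a → m₂-q₁ (trans (cong m₂ (p-injective (sym pl≡a))) m₂l≡a)

        Q-q₂ : Q q₂ ≡ y₂
        Q-q₂ with l , Ql≡y₂ ← Q-surjective (x∈p⊕x (B ⊕ y₀) y₂) with Q-cases l
        ... | inj₁ Ql≡m₂l = trans (cong Q (m₂-injective (trans m₂-q₂ (trans (sym Ql≡y₂) Ql≡m₂l)))) Ql≡y₂
        ... | inj₂ Ql≡pl  = contradiction (trans (sym Ql≡pl) Ql≡y₂) (p≢ l y₂∉A (y₀≢y₂ ∘ sym))

        -- In the linkage tree of `B + y₀ + y₁ + y₂`, `y₂` lies between `y₀` and `y₁`; deleting `y₂`
        -- there gives `p` off `q₁`, by `swap`.
        p-cases : ∀ l → l ≢ q₁ → p l ≡ N l ⊎ p l ≡ Q l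
        p-cases l l≢q₁ = subst (λ x → x ≡ N l ⊎ x ≡ Q l)
          (proj₂ (swap ∣A∣ y₀∉A y₁∉A y₀≢y₁ (≢a y₀∉A) (≢a y₁∉A) refl) l l≢q₁)
          (between′ (∣⊕⊕∣ (∣B⊕∣ y₁∉A) (y∉B⊕ y₀∉A (y₀≢y₁ ∘ sym)) (y∉B⊕ y₂∉A y₁≢y₂) y₀≢y₂)
            (p⊆p⊕x (x∈p⊕x _ y₀)) (p⊆p⊕x (p⊆p⊕x (x∈p⊕x B y₁))) (x∈p⊕x _ y₂)
            (⊕-⊕-⊖-cancel (y∉B⊕ y₀∉A (y₀≢y₁ ∘ sym)) y₀≢y₂)
            (trans (⊕-⊖-comm (y₁≢y₂ ∘ sym)) (cong (_⊕ y₂) (⊕-⊕-⊖-cancel (∉B y₁∉A) (y₀≢y₁ ∘ sym))))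
            (⊕-⊖-cancel λ y∈ → y∉B⊕ y₂∉A y₁≢y₂ (∈-⊕⁻ y∈ (y₀≢y₂ ∘ sym)))
            (λ k Nk≡y₂ Qk≡y₂ → N-q₂ (trans (cong N (Q-injective (trans Q-q₂ (sym Qk≡y₂)))) Nk≡y₂))
            l)

        -- These are the right nodes on the path from `a` to `y₂` in the linkage tree of
        -- `A + y₀ + y₂`.
        Regular : Fin d → Set
        Regular l = Q l ≡ m₂ l × p l ≢ m₂ l

        regular? : Decidable Regular
        regular? l = (Q l ≟ m₂ l) ×-dec ¬? (p l ≟ m₂ l)

        m₁≡N : ∀ {l} → m₁ l ≢ m₂ l → m₁ l ≡ N l
        m₁≡N {l} m₁≢m₂ with m₁-cases l
        ... | inj₁ eq = contradiction eq m₁≢m₂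
        ... | inj₂ eq = eq

        regular⇒p≡m₁ : ∀ {l} → l ≢ q₁ → m₁ l ≢ m₂ l → Regular l → p l ≡ m₁ l
        regular⇒p≡m₁ {l} l≢q₁ m₁≢m₂ (Q≡m₂ , p≢m₂) with p-cases l l≢q₁
        ... | inj₁ p≡N = trans p≡N (sym (m₁≡N m₁≢m₂))
        ... | inj₂ p≡Q = contradiction (trans p≡Q Q≡m₂) p≢m₂

        -- `l` follows `k` on the path from `y₂` to `y₁`. Since `p` already uses the left node
        -- between them at `k`, it cannot use it at `l`, and `Q` must.
        regular-step : ∀ {k l} → m₁ k ≢ m₂ k → m₂ l ≡ m₁ k → Regular k → Regular l
        regular-step {k} {l} m₁≢m₂ m₂l≡m₁k reg = Ql≡m₂l , pl≢m₂l
          where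
          k≢q₁ : k ≢ q₁
          k≢q₁ refl = m₂≢ l y₁∉A y₁≢y₂ (trans m₂l≡m₁k m₁-q₁)
          pk≡m₁k : p k ≡ m₁ k
          pk≡m₁k = regular⇒p≡m₁ k≢q₁ m₁≢m₂ reg
          l≢k : l ≢ k
          l≢k refl = m₁≢m₂ (sym m₂l≡m₁k)
          pl≢m₂l : p l ≢ m₂ l
          pl≢m₂l eq = l≢k (p-injective (trans eq (trans m₂l≡m₁k (sym pk≡m₁k))))
          m₁k∈A : m₁ k ∈ A
          m₁k∈A = ∈-⊕⁻ (O-∈ (∣⊕∣≡d ∣A∣ y₁∉A) k) λ eq → k≢q₁ (m₁-injective (trans eq (sym m₁-q₁)))
          m₁k∈ : m₁ k ∈ B ⊕ y₀ ⊕ y₂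
          m₁k∈ = p⊆p⊕x (p⊆p⊕x (∈-⊖⁺ m₁k∈A λ eq → N≢a k (trans (sym (m₁≡N m₁≢m₂)) eq)))
          Ql≡m₂l : Q l ≡ m₂ l
          Ql≡m₂l with l′ , Ql′≡m₁k ← Q-surjective m₁k∈ with Q-cases l′
          ... | inj₁ Q≡m₂ = trans (cong Q (m₂-injective (trans m₂l≡m₁k (trans (sym Ql′≡m₁k) Q≡m₂))))
                (trans Ql′≡m₁k (sym m₂l≡m₁k))
          ... | inj₂ Q≡p = contradiction
                (trans (sym Ql′≡m₁k) (trans (cong Q l′≡k) (proj₁ reg))) m₁≢m₂
            where
            l′≡k : l′ ≡ k
            l′≡k = p-injective (trans (sym Q≡p) (trans Ql′≡m₁k (sym pk≡m₁k)))

        -- Walking from y₂ towards y₁ in the linkage tree of A + y₁ + y₂ never leaves the regular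
        -- right nodes; irregular ones would therefore give two matchings with the same support.
        regular : ∀ {l} → m₁ l ≢ m₂ l → Regular l
        regular {l} m₁≢m₂ = decidable-stable (regular? l) λ ¬reg →
          m₁≢m₂ (support-determines (∣⊕∣≡d ∣A∣ y₁∉A) (∣⊕∣≡d ∣A∣ y₂∉A) P closed (m₁≢m₂ , ¬reg))
          where
          P : Fin d → Set
          P l = m₁ l ≢ m₂ l × ¬ Regular l
          closed : ∀ {l} → P l → ∃[ k ] P k × m₁ k ≡ m₂ l
          closed {l} (m₁≢m₂ , ¬reg) = k , (m₁k≢m₂k , ¬reg ∘ regular-step m₁k≢m₂k (sym m₁k≡m₂l)) , m₁k≡m₂l
            where
            m₂l∈A : m₂ l ∈ A
            -- `m₂ l` could only be `y₂` at `l = q₂`, where the walk starts, and `q₂` is regular.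
            m₂l∈A = ∈-⊕⁻ (O-∈ (∣⊕∣≡d ∣A∣ y₂∉A) l) λ eq → case m₂-injective (trans eq (sym m₂-q₂)) of λ
              { refl → ¬reg (trans Q-q₂ (sym m₂-q₂) , λ eq′ → p≢ q₂ y₂∉A (y₀≢y₂ ∘ sym) (trans eq′ m₂-q₂)) }
            k = μ (A ⊕ y₁) (m₂ l)
            m₁k≡m₂l : m₁ k ≡ m₂ l
            m₁k≡m₂l = O-μ (∣⊕∣≡d ∣A∣ y₁∉A) (p⊆p⊕x m₂l∈A)
            m₁k≢m₂k : m₁ k ≢ m₂ k
            m₁k≢m₂k eq = m₁≢m₂ (trans (cong m₁ (m₂-injective (trans (sym m₁k≡m₂l) eq))) m₁k≡m₂l)

      agree-⊆ : ∀ {l} → m₂ l ≡ p l → m₁ l ≡ p l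
      agree-⊆ {l} m₂≡p with m₁ l ≟ m₂ l
      ... | yes m₁≡m₂ = trans m₁≡m₂ m₂≡p
      ... | no m₁≢m₂  = contradiction (sym m₂≡p) (proj₂ (regular m₁≢m₂))

      agree-q₂ : m₁ q₂ ≡ p q₂
      agree-q₂ = sym (regular⇒p≡m₁ (q₁≢q₂ ∘ sym) m₁≢m₂ (regular m₁≢m₂))
        where
        m₁≢m₂ : m₁ q₂ ≢ m₂ q₂
        m₁≢m₂ eq = m₁≢ q₂ y₂∉A (y₁≢y₂ ∘ sym) (trans eq m₂-q₂)

      disagree-q₂ : m₂ q₂ ≢ p q₂
      disagree-q₂ eq = p≢ q₂ y₂∉A (y₀≢y₂ ∘ sym) (trans (sym eq) m₂-q₂)

  -- Replacing several edges of a matching by covector edges.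

  -- M_{A+y₀} remains a matching of the field after any of its edges are replaced by edges of the
  -- Chow covector at A.  The replacements are made one at a time, each time choosing one that keeps
  -- the later ones available.
  module Replacement (g : Fin d → Fin n) where

    Spec : Subset n → Fin n → Set
    Spec A y₀ = ∀ l → g l ≡ O (A ⊕ y₀) l ⊎ (g l ∉ A × μ (A ⊕ g l) (g l) ≡ l)

    changed? : ∀ A y₀ → Decidable (λ l → g l ≢ O (A ⊕ y₀) l)
    changed? A y₀ l = ¬? (g l ≟ O (A ⊕ y₀) l)

    module Step {A : Subset n} {y₀ : Fin n} (∣A∣ : suc ∣ A ∣ ≡ d) (y₀∉A : y₀ ∉ A)
      (g-r₀ : g (μ (A ⊕ y₀) y₀) ≡ y₀) (spec : Spec A y₀) where

      p : Fin d → Fin n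
      p = O (A ⊕ y₀)

      r₀ : Fin d
      r₀ = μ (A ⊕ y₀) y₀

      changed⇒ : ∀ {l} → g l ≢ p l → g l ∉ A × μ (A ⊕ g l) (g l) ≡ l
      changed⇒ {l} g≢p with spec l
      ... | inj₁ g≡p = contradiction g≡p g≢p
      ... | inj₂ s   = s

      changed⇒≢r₀ : ∀ {l} → g l ≢ p l → l ≢ r₀
      changed⇒≢r₀ g≢p refl = g≢p (trans g-r₀ (sym (O-last ∣A∣ y₀∉A)))

      changed-injective : ∀ {l l′} → g l ≢ p l → g l′ ≢ p l′ → g l ≡ g l′ → l ≡ l′
      changed-injective g≢p g≢p′ eq = trans (sym (proj₂ (changed⇒ g≢p)))
        (trans (cong (λ x → μ (A ⊕ x) x) eq) (proj₂ (changed⇒ g≢p′)))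

      -- Replacing `p l` by `g l` would move `g l′` out of its sector and spoil the replacement at
      -- `l′`.
      Crosses : Fin d → Fin d → Set
      Crosses l l′ = g l′ ≢ p l′ × l′ ≢ l × μ (A ⊖ p l ⊕ g l ⊕ g l′) (g l′) ≢ l′

      crosses? : ∀ l → Decidable (Crosses l)
      crosses? l l′ = ¬? (g l′ ≟ p l′) ×-dec (¬? (l′ ≟ l) ×-dec ¬? (μ (A ⊖ p l ⊕ g l ⊕ g l′) (g l′) ≟ l′))

      agree? : ∀ l → Decidable (λ k → O (A ⊕ g l) k ≡ p k)
      agree? l k = O (A ⊕ g l) k ≟ p k

      crossing : ∀ {l l′} → g l ≢ p l → Crosses l l′ → ⟦ agree? l′ ⟧ ⊂ ⟦ agree? l ⟧
      crossing {l} {l′} g≢p (g≢p′ , l′≢l , crossed) =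
        (λ k∈ → ∈-⟦⟧⁺ (agree? l) (C.agree-⊆ crossed′ (∈-⟦⟧⁻ (agree? l′) k∈)))
        , μ (A ⊕ g l′) (g l′)
        , ∈-⟦⟧⁺ (agree? l) (C.agree-q₂ crossed′)
        , λ k∈ → C.disagree-q₂ crossed′ (∈-⟦⟧⁻ (agree? l′) k∈)
        where
        ql = proj₂ (changed⇒ g≢p)
        ql′ = proj₂ (changed⇒ g≢p′)
        module C = Crossing ∣A∣ y₀∉A (proj₁ (changed⇒ g≢p)) (proj₁ (changed⇒ g≢p′))
          (λ eq → changed⇒≢r₀ g≢p (trans (sym ql) eq))
          (λ eq → changed⇒≢r₀ g≢p′ (trans (sym ql′) eq))
          (λ eq → l′≢l (trans (sym ql′) (trans (sym eq) ql)))
        crossed′ : μ (A ⊖ p (μ (A ⊕ g l) (g l)) ⊕ g l ⊕ g l′) (g l′) ≢ μ (A ⊕ g l′) (g l′)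
        crossed′ eq = crossed (trans (cong (λ k → μ (A ⊖ p k ⊕ g l ⊕ g l′) (g l′)) (sym ql)) (trans eq ql′))

      -- When a replacement crosses another one, pass to that one: by `crossing`, the agreement of
      -- `O (A ⊕ g l)` with `p` strictly shrinks, so the search ends.
      select : ∀ l → Acc _<_ ∣ ⟦ agree? l ⟧ ∣ → g l ≢ p l →
        ∃[ l₁ ] g l₁ ≢ p l₁ × (∀ l′ → ¬ Crosses l₁ l′)
      select l (acc rs) g≢p with any? (crosses? l)
      ... | no ¬∃          = l , g≢p , λ l′ c → ¬∃ (l′ , c)
      ... | yes (l′ , c) = select l′ (rs (p⊂q⇒∣p∣<∣q∣ (crossing g≢p c))) (proj₁ c)

      module Replace {l₁} (g≢p : g l₁ ≢ p l₁) (free : ∀ l′ → ¬ Crosses l₁ l′) where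

        y₁ = g l₁
        a = p l₁
        A′ = A ⊖ a ⊕ y₁

        y₁∉A : y₁ ∉ A
        y₁∉A = proj₁ (changed⇒ g≢p)
        q₁≡l₁ : μ (A ⊕ y₁) y₁ ≡ l₁
        q₁≡l₁ = proj₂ (changed⇒ g≢p)
        l₁≢r₀ : l₁ ≢ r₀
        l₁≢r₀ = changed⇒≢r₀ g≢p
        y₀≢y₁ : y₀ ≢ y₁
        y₀≢y₁ eq = l₁≢r₀ (trans (sym q₁≡l₁) (cong (λ x → μ (A ⊕ x) x) (sym eq)))
        a≢y₀ : a ≢ y₀
        a≢y₀ eq = l₁≢r₀ (sym (O⇒μ (∣⊕∣≡d ∣A∣ y₀∉A) eq))
        a∈A : a ∈ A
        a∈A = ∈-⊕⁻ (O-∈ (∣⊕∣≡d ∣A∣ y₀∉A) l₁) a≢y₀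
        ∉A′ : ∀ {x} → x ∉ A → x ≢ y₁ → x ∉ A′
        ∉A′ x∉A x≢y₁ x∈ = x∉A (p⊖x⊆p (∈-⊕⁻ x∈ x≢y₁))
        ∣A′∣ : suc ∣ A′ ∣ ≡ d
        ∣A′∣ = trans (cong suc (trans (∣p⊕x∣ (y₁∉A ∘ p⊖x⊆p)) (∣p⊖x∣ a∈A))) ∣A∣
        y₀∉A′ : y₀ ∉ A′
        y₀∉A′ = ∉A′ y₀∉A y₀≢y₁

        p′ : Fin d → Fin n
        p′ = O (A′ ⊕ y₀)

        swapped : p′ l₁ ≡ y₁ × (∀ l → l ≢ l₁ → p′ l ≡ p l)
        swapped = subst (λ q → p′ q ≡ y₁ × (∀ l → l ≢ q → p′ l ≡ p l)) q₁≡l₁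
          (swap ∣A∣ y₀∉A y₁∉A y₀≢y₁ a≢y₀ (λ { eq → y₁∉A (subst (_∈ A) eq a∈A) }) (cong p q₁≡l₁))

        r₀-kept : μ (A′ ⊕ y₀) y₀ ≡ r₀
        r₀-kept = O⇒μ (∣⊕∣≡d ∣A′∣ y₀∉A′)
          (trans (proj₂ swapped r₀ (l₁≢r₀ ∘ sym)) (O-last ∣A∣ y₀∉A))

        g-r₀′ : g (μ (A′ ⊕ y₀) y₀) ≡ y₀
        g-r₀′ = trans (cong g r₀-kept) g-r₀

        spec′ : Spec A′ y₀
        spec′ l with l ≟ l₁ | g l ≟ p l
        ... | yes refl | _       = inj₁ (sym (proj₁ swapped))
        ... | no l≢l₁  | yes g≡p = inj₁ (trans g≡p (sym (proj₂ swapped l l≢l₁)))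
        ... | no l≢l₁  | no g≢p′ = inj₂
          ( ∉A′ (proj₁ (changed⇒ g≢p′)) (λ eq → l≢l₁ (changed-injective g≢p′ g≢p eq))
          , decidable-stable (μ (A′ ⊕ g l) (g l) ≟ l) λ ≢l → free l (g≢p′ , l≢l₁ , ≢l))

        fewer : ⟦ changed? A′ y₀ ⟧ ⊂ ⟦ changed? A y₀ ⟧
        fewer = (λ {l} l∈ → ∈-⟦⟧⁺ (changed? A y₀) λ g≡p → case l ≟ l₁ of λ where
                  (yes refl) → g≢p g≡p
                  (no l≢l₁)  → ∈-⟦⟧⁻ (changed? A′ y₀) l∈ (trans g≡p (sym (proj₂ swapped l l≢l₁))))
              , l₁ , ∈-⟦⟧⁺ (changed? A y₀) g≢p
              , λ l₁∈ → ∈-⟦⟧⁻ (changed? A′ y₀) l₁∈ (sym (proj₁ swapped))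

    replace : ∀ {A y₀} → Acc _<_ ∣ ⟦ changed? A y₀ ⟧ ∣ → suc ∣ A ∣ ≡ d → y₀ ∉ A →
      g (μ (A ⊕ y₀) y₀) ≡ y₀ → Spec A y₀ → ∃[ σ ] ∣ σ ∣ ≡ d × (∀ l → O σ l ≡ g l)
    replace {A} {y₀} (acc rs) ∣A∣ y₀∉A g-r₀ spec with any? (changed? A y₀)
    ... | no ¬∃ = A ⊕ y₀ , ∣⊕∣≡d ∣A∣ y₀∉A , λ l → sym (decidable-stable (g l ≟ O (A ⊕ y₀) l) λ g≢p → ¬∃ (l , g≢p))
    ... | yes (l , g≢p) = replace (rs (p⊂q⇒∣p∣<∣q∣ R.fewer)) R.∣A′∣ R.y₀∉A′ R.g-r₀′ R.spec′
      where
      open Step ∣A∣ y₀∉A g-r₀ spec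
      selected = select l (<-wellFounded _) g≢p
      module R = Replace (proj₁ (proj₂ selected)) (proj₂ (proj₂ selected))

  -- Topes and their transversals.

  tope : Subset n → Fin n → Fin n → Fin d
  tope A y₀ x with x ∈? A
  ... | yes _ = μ (A ⊕ y₀) x
  ... | no  _ = μ (A ⊕ x) x

  tope-∈ : ∀ {A y₀ x} → x ∈ A → tope A y₀ x ≡ μ (A ⊕ y₀) x
  tope-∈ {A} {x = x} x∈A with x ∈? A
  ... | yes _  = refl
  ... | no x∉A = contradiction x∈A x∉A

  tope-∉ : ∀ {A y₀ x} → x ∉ A → tope A y₀ x ≡ μ (A ⊕ x) x
  tope-∉ {A} {x = x} x∉A with x ∈? A
  ... | yes x∈A = contradiction x∈A x∉A
  ... | no  _   = refl

  tope-O : ∀ {A y₀} → suc ∣ A ∣ ≡ d → y₀ ∉ A → ∀ l → tope A y₀ (O (A ⊕ y₀) l) ≡ l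
  tope-O {A} {y₀} ∣A∣ y₀∉A l with O (A ⊕ y₀) l ≟ y₀
  ... | yes eq = trans (cong (tope A y₀) eq) (trans (tope-∉ y₀∉A) (O⇒μ (∣⊕∣≡d ∣A∣ y₀∉A) eq))
  ... | no ≢y₀ = trans (tope-∈ (∈-⊕⁻ (O-∈ (∣⊕∣≡d ∣A∣ y₀∉A) l) ≢y₀)) (μ-O (∣⊕∣≡d ∣A∣ y₀∉A) l)

  ∈⇒≢last : ∀ {A y₀ x} → suc ∣ A ∣ ≡ d → y₀ ∉ A → x ∈ A → μ (A ⊕ y₀) x ≢ μ (A ⊕ y₀) y₀
  ∈⇒≢last {A} {y₀} {x} ∣A∣ y₀∉A x∈A eq = y₀∉A (subst (_∈ A)
    (perfect 𝓜 (A ⊕ y₀) (∣⊕∣≡d ∣A∣ y₀∉A) x y₀ (p⊆p⊕x x∈A) (x∈p⊕x A y₀) eq) x∈A)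

  -- The node `y` that `g` picks at `r` lies outside `A`, and by `same-sector` the matchings of
  -- `A ⊕ y` and `A ⊕ y₀` agree off `r`. With `y` as base point, `g` departs from the matching only
  -- in covector edges.
  transversal : ∀ {A y₀} → suc ∣ A ∣ ≡ d → y₀ ∉ A → (g : Fin d → Fin n) → (∀ l → tope A y₀ (g l) ≡ l) →
    ∃[ σ ] ∣ σ ∣ ≡ d × (∀ l → O σ l ≡ g l)
  transversal {A} {y₀} ∣A∣ y₀∉A g g-spec =
    Replacement.replace g (<-wellFounded _) ∣A∣ y∉A (cong g y-r) spec
    where
    r = μ (A ⊕ y₀) y₀
    y = g r
    y∉A : y ∉ A
    y∉A y∈A = ∈⇒≢last ∣A∣ y₀∉A y∈A (trans (sym (tope-∈ y∈A)) (g-spec r))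
    y-r : μ (A ⊕ y) y ≡ r
    y-r = trans (sym (tope-∉ y∉A)) (g-spec r)
    spec : Replacement.Spec g A y
    spec l with g l ∈? A
    ... | no ∉A  = inj₂ (∉A , trans (sym (tope-∉ ∉A)) (g-spec l))
    ... | yes ∈A = inj₁ (trans (sym (subst (λ k → O (A ⊕ y₀) k ≡ g l) gl-l (O-μ (∣⊕∣≡d ∣A∣ y₀∉A) (p⊆p⊕x ∈A))))
        (sym (same-sector ∣A∣ y∉A y₀∉A y-r l λ l≡r → ∈⇒≢last ∣A∣ y₀∉A ∈A (trans gl-l l≡r))))
      where
      gl-l : μ (A ⊕ y₀) (g l) ≡ l
      gl-l = trans (sym (tope-∈ ∈A)) (g-spec l)

  -- Sectors, fibres of topes, and right degrees.

  sector? : ∀ A l → Decidable (λ x → x ∉ A × μ (A ⊕ x) x ≡ l)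
  sector? A l x = ¬? (x ∈? A) ×-dec (μ (A ⊕ x) x ≟ l)

  sector : Subset n → Fin d → Subset n
  sector A l = ⟦ sector? A l ⟧

  fibre? : ∀ A y₀ l → Decidable (λ x → tope A y₀ x ≡ l)
  fibre? A y₀ l x = tope A y₀ x ≟ l

  fibre : Subset n → Fin n → Fin d → Subset n
  fibre A y₀ l = ⟦ fibre? A y₀ l ⟧

  module _ {A : Subset n} {y₀ : Fin n} (∣A∣ : suc ∣ A ∣ ≡ d) (y₀∉A : y₀ ∉ A) where

    sector⊆fibre : ∀ {l} → sector A l ⊆ fibre A y₀ l
    sector⊆fibre {l} x∈ with x∉A , eq ← ∈-⟦⟧⁻ (sector? A l) x∈ =
      ∈-⟦⟧⁺ (fibre? A y₀ l) (trans (tope-∉ x∉A) eq)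

    fibre-∉ : ∀ {l x} → x ∈ fibre A y₀ l → x ∉ A → x ∈ sector A l
    fibre-∉ {l} x∈ x∉A = ∈-⟦⟧⁺ (sector? A l) (x∉A , trans (sym (tope-∉ x∉A)) (∈-⟦⟧⁻ (fibre? A y₀ l) x∈))

    fibre-∈ : ∀ {l x} → x ∈ fibre A y₀ l → x ∈ A → O (A ⊕ y₀) l ≡ x
    fibre-∈ {l} {x} x∈ x∈A = subst (λ k → O (A ⊕ y₀) k ≡ x)
      (trans (sym (tope-∈ x∈A)) (∈-⟦⟧⁻ (fibre? A y₀ l) x∈)) (O-μ (∣⊕∣≡d ∣A∣ y₀∉A) (p⊆p⊕x x∈A))

    fibre-last : fibre A y₀ (μ (A ⊕ y₀) y₀) ≡ sector A (μ (A ⊕ y₀) y₀)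
    fibre-last = ⊆-antisym (λ {x} x∈ → fibre-∉ x∈ λ x∈A → y₀∉A (subst (_∈ A)
        (trans (sym (fibre-∈ x∈ x∈A)) (O-last ∣A∣ y₀∉A)) x∈A)) sector⊆fibre

    -- The fibre adds to the sector the node of `A` that the matching of `A ⊕ y₀` assigns to `l`;
    -- only the partner of `y₀` has none.
    ∣fibre∣ : ∀ {l} → l ≢ μ (A ⊕ y₀) y₀ → ∣ fibre A y₀ l ∣ ≡ suc ∣ sector A l ∣
    ∣fibre∣ {l} l≢r = trans (cong ∣_∣ (⊆-antisym to from)) (∣p⊕x∣ a∉sector)
      where
      a = O (A ⊕ y₀) l
      a∈A : a ∈ A
      a∈A = ∈-⊕⁻ (O-∈ (∣⊕∣≡d ∣A∣ y₀∉A) l) λ eq → l≢r (sym (O⇒μ (∣⊕∣≡d ∣A∣ y₀∉A) eq))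
      a∉sector : a ∉ sector A l
      a∉sector a∈ = proj₁ (∈-⟦⟧⁻ (sector? A l) a∈) a∈A
      to : fibre A y₀ l ⊆ sector A l ⊕ a
      to {x} x∈ with x ∈? A
      ... | yes x∈A = subst (_∈ sector A l ⊕ a) (fibre-∈ x∈ x∈A) (x∈p⊕x (sector A l) a)
      ... | no x∉A  = p⊆p⊕x (fibre-∉ x∈ x∉A)
      from : sector A l ⊕ a ⊆ fibre A y₀ l
      from {x} x∈ with x ≟ a
      ... | yes refl = ∈-⟦⟧⁺ (fibre? A y₀ l) (tope-O ∣A∣ y₀∉A l)
      ... | no x≢a   = sector⊆fibre (∈-⊕⁻ x∈ x≢a)

  -- Two topes with equal right degrees: send l to the right node which the second tope assigns to
  -- some x with F x = l that it moves.  A cycle of this map yields two matchings of the field with the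
  -- same support.
  topes-agree : ∀ {A B y z} → suc ∣ A ∣ ≡ d → suc ∣ B ∣ ≡ d → y ∉ A → z ∉ B →
    (∀ l → ∣ fibre A y l ∣ ≡ ∣ fibre B z l ∣) → ∀ x → tope A y x ≡ tope B z x
  topes-agree {A} {B} {y} {z} ∣A∣ ∣B∣ y∉A z∉B sizes x₀ =
    decidable-stable (F x₀ ≟ G x₀) λ ≢x₀ → absurd (x₀ , refl , ≢x₀ ∘ sym)
    where
    F = tope A y
    G = tope B z
    Moved : Fin d → Set
    Moved l = ∃[ x ] F x ≡ l × G x ≢ l
    moved? : Decidable Moved
    moved? l = any? λ x → (F x ≟ l) ×-dec ¬? (G x ≟ l)
    pick : Fin d → Fin n
    pick l with moved? l
    ... | yes (x , _) = x
    ... | no  _       = O (A ⊕ y) l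
    F-pick : ∀ l → F (pick l) ≡ l
    F-pick l with moved? l
    ... | yes (x , eq , _) = eq
    ... | no  _            = tope-O ∣A∣ y∉A l
    φ : Fin d → Fin d
    φ l = G (pick l)
    φ-≢ : ∀ {l} → Moved l → φ l ≢ l
    φ-≢ {l} m with moved? l
    ... | yes (_ , _ , ≢l) = ≢l
    ... | no ¬m            = contradiction m ¬m
    -- Otherwise the `F`-fibre of `φ l` would lie in its `G`-fibre, which contains `pick l` in
    -- addition, against equal sizes.
    moved-φ : ∀ {l} → Moved l → Moved (φ l)
    moved-φ {l} m = decidable-stable (moved? (φ l)) λ ¬m →
      <⇒≢ (p⊂q⇒∣p∣<∣q∣ (subset ¬m , pick l , ∈-⟦⟧⁺ (fibre? B z (φ l)) refl
        , λ ∈F → φ-≢ m (trans (sym (∈-⟦⟧⁻ (fibre? A y (φ l)) ∈F)) (F-pick l)))) (sizes (φ l))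
      where
      subset : ¬ Moved (φ l) → fibre A y (φ l) ⊆ fibre B z (φ l)
      subset ¬m {x} x∈ = ∈-⟦⟧⁺ (fibre? B z (φ l)) (decidable-stable (G x ≟ φ l)
        λ ≢φl → ¬m (x , ∈-⟦⟧⁻ (fibre? A y (φ l)) x∈ , ≢φl))
    absurd : ¬ Moved (F x₀)
    absurd m₀ = φ-≢ (proj₁ P-l₀) (trans (cong G (sym agree)) (G-g′ l₀))
      where
      per = periodic-point φ (F x₀)
      k = proj₁ (proj₂ per)
      l₀ = iterate φ (proj₁ per) (F x₀)
      P : Fin d → Set
      P l = Moved l × iterate φ (suc k) l ≡ l
      P? : Decidable P
      P? l = moved? l ×-dec (iterate φ (suc k) l ≟ l)
      P-l₀ : P l₀
      P-l₀ = iterate-preserves φ Moved moved-φ (proj₁ per) m₀ , proj₂ (proj₂ per)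
      iterate-φ : ∀ j l → iterate φ j (φ l) ≡ φ (iterate φ j l)
      iterate-φ j l = trans (sym (iterate-+ φ j 1 l)) (cong (λ i → iterate φ i l) (+-comm j 1))
      P-φ : ∀ {l} → P l → P (φ l)
      P-φ {l} (m , eq) = moved-φ m , trans (iterate-φ (suc k) l) (cong φ eq)
      g : Fin d → Fin n
      g = pick
      -- `iterate φ k` inverts `φ` on `P`, so there `g′` is `pick` shifted one step along the
      -- cycles: the same support with different partners.
      g′ : Fin d → Fin n
      g′ l with P? l
      ... | yes _ = pick (iterate φ k l)
      ... | no  _ = O (B ⊕ z) l
      G-g′ : ∀ l → G (g′ l) ≡ l
      G-g′ l with P? l
      ... | yes (_ , eq) = eq
      ... | no  _        = tope-O ∣B∣ z∉B l
      g′-φ : ∀ {l} → P l → g′ (φ l) ≡ pick l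
      g′-φ {l} Pl with P? (φ l)
      ... | yes _ = cong pick (trans (iterate-φ k l) (proj₂ Pl))
      ... | no ¬P = contradiction (P-φ Pl) ¬P
      S = transversal ∣A∣ y∉A g F-pick
      T = transversal ∣B∣ z∉B g′ G-g′
      agree : g′ l₀ ≡ pick l₀
      agree = trans (sym (proj₂ (proj₂ T) l₀)) (trans
        (support-determines (proj₁ (proj₂ T)) (proj₁ (proj₂ S)) P
          (λ {l} Pl → φ l , P-φ Pl , trans (proj₂ (proj₂ T) (φ l))
            (trans (g′-φ Pl) (sym (proj₂ (proj₂ S) l)))) P-l₀)
        (proj₂ (proj₂ S) l₀))

  -- For `y` in `B` but not in `A`, take `z` in the sector of `B` at `r = μ (A ⊕ y) y`. Both base
  -- points then sit at `r`, so the fibre sizes match and the topes agree; but the second sends `y`,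
  -- being in `B`, to a right node other than `r`.
  sectors-determine : ∀ {A B} → suc ∣ A ∣ ≡ d → suc ∣ B ∣ ≡ d →
    (∀ l → ∣ sector A l ∣ ≡ ∣ sector B l ∣) → A ≡ B
  sectors-determine {A} {B} ∣A∣ ∣B∣ sizes = sym (⊆∧∣∣≤⇒≡
    (λ {y} y∈B → decidable-stable (y ∈? A) (separated y∈B))
    (≤-reflexive (cong Data.Nat.pred (trans ∣A∣ (sym ∣B∣)))))
    where
    separated : ∀ {y} → y ∈ B → ¬ (y ∉ A)
    separated {y} y∈B y∉A
      with z , z∈ ← ∣∣>0⇒Nonempty (sector B (μ (A ⊕ y) y))
        (subst (0 <_) (sizes _) (∈⇒∣∣>0 {p = sector A (μ (A ⊕ y) y)} (∈-⟦⟧⁺ (sector? A _) (y∉A , refl))))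
      with z∉B , z-r ← ∈-⟦⟧⁻ (sector? B _) z∈
      = ∈⇒≢last ∣B∣ z∉B y∈B (trans (sym (tope-∈ y∈B)) (trans (sym (topes-agree ∣A∣ ∣B∣ y∉A z∉B equal y))
          (trans (tope-∉ y∉A) (sym z-r))))
      where
      equal : ∀ l → ∣ fibre A y l ∣ ≡ ∣ fibre B z l ∣
      equal l with l ≟ μ (A ⊕ y) y
      ... | yes refl = trans (cong ∣_∣ (fibre-last ∣A∣ y∉A)) (trans (sizes l)
            (cong ∣_∣ (sym (subst (λ r → fibre B z r ≡ sector B r) z-r (fibre-last ∣B∣ z∉B)))))
      ... | no l≢r = trans (∣fibre∣ ∣A∣ y∉A l≢r) (trans (cong suc (sizes l))
            (sym (∣fibre∣ ∣B∣ z∉B λ eq → l≢r (trans eq z-r))))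

-- Right degree vectors of Chow covectors as lattice points.

theorem3p23 : (n d : ℕ) → 1 ≤ d → d ≤ n →
    (𝓜 : MatchingField n d) → IsLinkage 𝓜 →
    ((Ω : ChowCovectors 𝓜) → sum (rightDegree (proj₁ Ω)) ≡ n ∸ d + 1)
    × ((Ω Ω′ : ChowCovectors 𝓜) →
    rightDegree (proj₁ Ω) ≡ rightDegree (proj₁ Ω′) → proj₁ Ω ≡ proj₁ Ω′)
    × ((v : LatticePoint n d) →
    Σ (ChowCovectors 𝓜) λ Ω → rightDegree (proj₁ Ω) ≡ proj₁ v)
theorem3p23 n (suc d) _ d<n 𝓜 linkage = degree-sum , degrees-determine , degrees-exhaust
  where
  open Matchings d<n 𝓜 linkage

  -- There are `suc d` right nodes, so `A` has `d` elements and its complement has `n ∸ suc d + 1`.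
  m+d≡n : n ∸ suc d + 1 + d ≡ n
  m+d≡n = trans (+-assoc (n ∸ suc d) 1 d) (m∸n+n≡m d<n)

  edge? : ∀ ρ r → Decidable (λ i → i ∈ ρ × M 𝓜 (∁ ρ ∪ ⁅ i ⁆) i ≡ r)
  edge? ρ r i = (i ∈? ρ) ×-dec (M 𝓜 (∁ ρ ∪ ⁅ i ⁆) i ≟ r)

  rightDegree-chow : ∀ ρ → rightDegree (chow 𝓜 ρ) ≡ tabulate λ r → ∣ ⟦ edge? ρ r ⟧ ∣
  rightDegree-chow ρ = tabulate-cong λ r → trans
    (length-filter-≟true (λ i → lookup (lookup (chow 𝓜 ρ) i) r) id)
    (cong ∣_∣ (tabulate-cong λ i → trans (cong (λ row → lookup row r) (lookup∘tabulate row i))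
      (lookup∘tabulate (λ r′ → does (edge? ρ r′ i)) r)))
    where
    row : Fin n → Vec Bool (suc d)
    row i = tabulate λ r → does (edge? ρ r i)

  sectors : Subset n → Vec ℕ (suc d)
  sectors A = tabulate λ l → ∣ sector A l ∣

  rightDegree-sectors : ∀ ρ → rightDegree (chow 𝓜 ρ) ≡ sectors (∁ ρ)
  rightDegree-sectors ρ = trans (rightDegree-chow ρ) (tabulate-cong λ r → cong ∣_∣ (⊆-antisym
    (λ {i} i∈ → let (i∈ρ , eq) = ∈-⟦⟧⁻ (edge? ρ r) i∈ in ∈-⟦⟧⁺ (sector? (∁ ρ) r)
      (x∈p⇒x∉∁p i∈ρ , trans (cong (λ p → M 𝓜 p i) (sym (∪-⁅⁆ (∁ ρ) i))) eq))
    (λ {i} i∈ → let (i∉ , eq) = ∈-⟦⟧⁻ (sector? (∁ ρ) r) i∈ in ∈-⟦⟧⁺ (edge? ρ r)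
      (x∉∁p⇒x∈p i∉ , trans (cong (λ p → M 𝓜 p i) (∪-⁅⁆ (∁ ρ) i)) eq))))

  ∣∁∣ : ∀ {ρ} → ∣ ρ ∣ ≡ n ∸ suc d + 1 → suc ∣ ∁ ρ ∣ ≡ suc d
  ∣∁∣ {ρ} ∣ρ∣ = cong suc (begin
    ∣ ∁ ρ ∣                                ≡⟨ ∣∁p∣≡n∸∣p∣ ρ ⟩
    n ∸ ∣ ρ ∣                              ≡⟨ cong₂ _∸_ (sym m+d≡n) ∣ρ∣ ⟩
    n ∸ suc d + 1 + d ∸ (n ∸ suc d + 1)    ≡⟨ m+n∸m≡n (n ∸ suc d + 1) d ⟩
    d                                      ∎)
    where open ≡-Reasoning

  ∣∁∣′ : ∀ {A} → suc ∣ A ∣ ≡ suc d → ∣ ∁ A ∣ ≡ n ∸ suc d + 1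
  ∣∁∣′ {A} ∣A∣ = begin
    ∣ ∁ A ∣               ≡⟨ ∣∁p∣≡n∸∣p∣ A ⟩
    n ∸ ∣ A ∣             ≡⟨ cong₂ _∸_ (sym m+d≡n) (cong Data.Nat.pred ∣A∣) ⟩
    n ∸ suc d + 1 + d ∸ d ≡⟨ m+n∸n≡m (n ∸ suc d + 1) d ⟩
    n ∸ suc d + 1         ∎
    where open ≡-Reasoning

  degree-sum : (Ω : ChowCovectors 𝓜) → sum (rightDegree (proj₁ Ω)) ≡ n ∸ suc d + 1
  degree-sum (_ , ρ , ∣ρ∣ , refl) = trans (cong sum (rightDegree-chow ρ))
    (trans (sum-∣fibres∣ ρ λ i → M 𝓜 (∁ ρ ∪ ⁅ i ⁆) i) ∣ρ∣)

  sectors-injective : ∀ {A B} → suc ∣ A ∣ ≡ suc d → suc ∣ B ∣ ≡ suc d → sectors A ≡ sectors B → A ≡ B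
  sectors-injective {A} {B} ∣A∣ ∣B∣ eq = sectors-determine ∣A∣ ∣B∣ λ l →
    trans (sym (lookup∘tabulate (λ k → ∣ sector A k ∣) l))
      (trans (cong (λ v → lookup v l) eq) (lookup∘tabulate (λ k → ∣ sector B k ∣) l))

  degrees-determine : (Ω Ω′ : ChowCovectors 𝓜) →
    rightDegree (proj₁ Ω) ≡ rightDegree (proj₁ Ω′) → proj₁ Ω ≡ proj₁ Ω′
  degrees-determine (_ , ρ , ∣ρ∣ , refl) (_ , ρ′ , ∣ρ′∣ , refl) eq = cong (chow 𝓜) (begin
    ρ         ≡⟨ ∁-involutive ρ ⟨
    ∁ (∁ ρ)   ≡⟨ cong ∁ (sectors-injective (∣∁∣ {ρ} ∣ρ∣) (∣∁∣ {ρ′} ∣ρ′∣)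
                   (trans (sym (rightDegree-sectors ρ)) (trans eq (rightDegree-sectors ρ′)))) ⟩
    ∁ (∁ ρ′)  ≡⟨ ∁-involutive ρ′ ⟩
    ρ′        ∎)
    where open ≡-Reasoning

  covector : ∀ A → suc ∣ A ∣ ≡ suc d → ChowCovectors 𝓜
  covector A ∣A∣ = chow 𝓜 (∁ A) , ∁ A , ∣∁∣′ {A} ∣A∣ , refl

  rightDegree-covector : ∀ A (∣A∣ : suc ∣ A ∣ ≡ suc d) → rightDegree (proj₁ (covector A ∣A∣)) ≡ sectors A
  rightDegree-covector A ∣A∣ = trans (rightDegree-sectors (∁ A)) (cong sectors (∁-involutive A))

  sum-sectors : ∀ {A} → suc ∣ A ∣ ≡ suc d → sum (sectors A) + d ≡ n
  sum-sectors {A} ∣A∣ = trans (cong (_+ d) (trans (cong sum (sym (rightDegree-covector A ∣A∣)))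
    (degree-sum (covector A ∣A∣)))) m+d≡n

  -- Since subsets of size d index the lattice points as well, A ↦ sectors A becomes an injective
  -- self-map of the set of subsets of L.
  self : Subset n → Subset n
  self A with suc ∣ A ∣ Data.Nat.≟ suc d
  ... | yes _ = stars-and-bars n (sectors A)
  ... | no  _ = A

  self-injective : ∀ {A B} → self A ≡ self B → A ≡ B
  self-injective {A} {B} eq with suc ∣ A ∣ Data.Nat.≟ suc d | suc ∣ B ∣ Data.Nat.≟ suc d
  ... | yes ∣A∣ | yes ∣B∣ = sectors-injective ∣A∣ ∣B∣
    (stars-and-bars-injective n _ _ (sum-sectors {A} ∣A∣) (sum-sectors {B} ∣B∣) eq)
  ... | yes ∣A∣ | no ¬∣B∣ = contradiction
    (cong suc (trans (cong ∣_∣ (sym eq)) (∣stars-and-bars∣ n _ (sum-sectors {A} ∣A∣)))) ¬∣B∣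
  ... | no ¬∣A∣ | yes ∣B∣ = contradiction
    (cong suc (trans (cong ∣_∣ eq) (∣stars-and-bars∣ n _ (sum-sectors {B} ∣B∣)))) ¬∣A∣
  ... | no _    | no _    = eq

  -- The preimage `A` of the code of `v` has size `d`, for otherwise `self` fixes it and `A` is that
  -- code, which has size `d`.
  degrees-exhaust : (v : LatticePoint n (suc d)) →
    Σ (ChowCovectors 𝓜) λ Ω → rightDegree (proj₁ Ω) ≡ proj₁ v
  degrees-exhaust (v , sum-v)
    with A , eq ← injective⇒surjective subset-code subset-code-injective self-injective (stars-and-bars n v)
    with suc ∣ A ∣ Data.Nat.≟ suc d
  ... | yes ∣A∣ = covector A ∣A∣ , trans (rightDegree-covector A ∣A∣)
    (stars-and-bars-injective n _ v (sum-sectors {A} ∣A∣) (trans (cong (_+ d) sum-v) m+d≡n) eq)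
  ... | no ¬∣A∣ = contradiction
    (cong suc (trans (cong ∣_∣ eq) (∣stars-and-bars∣ n v (trans (cong (_+ d) sum-v) m+d≡n)))) ¬∣A∣
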